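{- Let $P\in\mathbb{Z}[x]$ be a monic polynomial (not necessarily irreducible). Then for every positive integer $n$, $$\sum_{m\mid n}\mu\Big(\frac nm\Big)\Delta(P_m)\equiv 0 \pmod n,$$ where $\mu$ is the Möbius function.
   Context: If $P$ has degree $d$ and roots $\alpha_1,\dots,\alpha_d$ (with multiplicity), then for each integer $n\ge1$, $P_n(x):=\prod_{j=1}^d(x-\alpha_j^n)\in\mathbb{Z}[x]$, and $\Delta(P_n)=\prod_{1\le j<k\le d}(\alpha_j^n-\alpha_k^n)^2$ denotes its discriminant. -}

module Defs where

open import Level as Level using (Level)
open import Data.Nat as ℕ using (ℕ; zero; suc; NonZero)
open import Data.Nat.Divisibility using (_∣?_)
open import Data.Nat.DivMod using (_/_)
open import Data.Nat.Primality.Factorisation using (factorise; factors)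
open import Data.Integer as ℤ using (ℤ; +_; -[1+_])
open import Data.List as List using (List; []; _∷_; length; upTo)
open import Data.List.Relation.Unary.Unique.DecPropositional ℕ._≟_ using (unique?)
open import Data.Fin as Fin using (Fin)
open import Data.Vec as Vec using (Vec; []; _∷_; _∷ʳ_)
open import Data.Vec.Relation.Binary.Pointwise.Inductive using (Pointwise)
open import Relation.Nullary using (yes; no)
open import Algebra.Bundles using (CommutativeRing)

signPow : ℕ → ℤ
signPow zero    = + 1
signPow (suc k) = ℤ.- signPow k

μ : ℕ → ℤ
μ zero = + 0
μ n@(suc _) with unique? (factors (factorise n))
... | yes _ = signPow (length (factors (factorise n)))
... | no  _ = + 0

module _ {c ℓ : Level} (R : CommutativeRing c ℓ) where
  open CommutativeRing R

  fromℕ : ℕ → Carrier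
  fromℕ zero    = 0#
  fromℕ (suc n) = 1# + fromℕ n

  fromℤ : ℤ → Carrier
  fromℤ (+ n)      = fromℕ n
  fromℤ -[1+ n ]   = - fromℕ (suc n)

  pow : Carrier → ℕ → Carrier
  pow x zero    = 1#
  pow x (suc n) = x * pow x n

  prodFin : ∀ d → (Fin d → Carrier) → Carrier
  prodFin zero    f = 1#
  prodFin (suc d) f = f Fin.zero * prodFin d (λ k → f (Fin.suc k))

  -- Polynomials: coefficient vectors, entry i = coefficient of x^i.
  -- (x - a) · p  for p of degree ≤ n.
  mulLinear : ∀ {n} → Vec Carrier (suc n) → Carrier → Vec Carrier (suc (suc n))
  mulLinear p a = Vec.zipWith _-_ (0# ∷ p) (Vec.map (a *_) p ∷ʳ 0#)

  rootPoly : ∀ d → (Fin d → Carrier) → Vec Carrier (suc d)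
  rootPoly zero    α = 1# ∷ []
  rootPoly (suc d) α = mulLinear (rootPoly d (λ k → α (Fin.suc k))) (α Fin.zero)

  -- The monic integer polynomial  P = x^d + a_{d-1} x^{d-1} + ... + a_0
  -- (given by a = (a_0,...,a_{d-1})) splits in R with roots α_1..α_d
  -- (with multiplicity):  P = ∏_j (x - α_j)  in R[x].
  Splits : ∀ {d} → Vec ℤ d → (Fin d → Carrier) → Set (c Level.⊔ ℓ)
  Splits {d} a α = Pointwise _≈_ (rootPoly d α) (Vec.map fromℤ (a ∷ʳ + 1))

  discRoots : ∀ d → (Fin d → Carrier) → Carrier
  discRoots zero    β = 1#
  discRoots (suc d) β =
    prodFin d (λ k → pow (β Fin.zero - β (Fin.suc k)) 2)
      * discRoots d (λ k → β (Fin.suc k))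

  ΔP : ∀ {d} → (Fin d → Carrier) → ℕ → Carrier
  ΔP {d} α m = discRoots d (λ j → pow (α j) m)

  sumList : List Carrier → Carrier
  sumList []       = 0#
  sumList (x ∷ xs) = x + sumList xs

  möbiusDiscSum : ∀ {d} → (Fin d → Carrier) → ℕ → Carrier
  möbiusDiscSum α n = sumList (List.map term (upTo n))
    where
    term : ℕ → Carrier
    term i with suc i ∣? n
    ... | yes _ = fromℤ (μ (n / suc i)) * ΔP α (suc i)
    ... | no  _ = 0#

module Submission where

open import Defs
open import Level using (Level)
open import Data.Nat using (ℕ; _≤_)
open import Data.Integer as ℤ using (ℤ; +_)
open import Data.Fin using (Fin)
open import Data.Vec using (Vec)
open import Data.Product using (∃-syntax)
open import Algebra.Bundles using (CommutativeRing)

open import Data.Nat as ℕ using (zero; suc; z≤n; s≤s; NonZero)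
import Data.Nat.Properties as ℕₚ
open import Data.Nat.Divisibility
  using (_∣_; _∤_; _∣?_; divides; n/m≡quotient; >⇒∤; ∣-refl; ∣-trans; 1∣_; n∣m*n; m∣m*n;
         ∣m+n∣m⇒∣n; ∣m∣n⇒∣m+n; *-monoʳ-∣; *-monoˡ-∣; *-cancelʳ-∣; m∣n*o⇒m/n∣o; m/n∣o⇒m∣o*n)
open import Data.Nat.DivMod using (_/_; m*[n/m]≡n)
open import Data.Nat.GCD
  using (gcd; gcd[m,n]∣m; gcd[m,n]∣n; gcd[m,n]≢0; gcd-greatest; c*gcd[m,n]≡gcd[cm,cn])
open import Data.Nat.LCM using (lcm; m∣lcm[m,n]; n∣lcm[m,n]; lcm-least; gcd*lcm)
open import Data.Nat.ListAction.Properties using (∈⇒∣product)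
open import Data.Nat.Primality using (Prime; euclidsLemma; prime⇒nonZero)
open import Data.Nat.Primality.Factorisation
  using (PrimeFactorisation; factorise; factors; factorisationUnique; factorisationHasAllPrimeFactors)
open import Data.Integer using (-[1+_])
import Data.Integer.Properties as ℤₚ
open import Data.Integer.Solver using (module +-*-Solver)
import Data.Fin as Fin
open import Data.Vec as Vec using ([]; _∷_; _∷ʳ_; lookup; updateAt)
open import Data.Vec.Relation.Binary.Pointwise.Inductive using (Pointwise; []; _∷_)
open import Data.List as List using (List; []; _∷_; length; upTo; applyUpTo)
open import Data.List.Membership.Propositional using (_∈_; _∉_)
open import Data.List.Relation.Unary.All using (_∷_)
open import Data.List.Relation.Unary.All.Properties using (¬Any⇒All¬; All¬⇒¬Any)
open import Data.List.Relation.Unary.AllPairs using (_∷_)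
open import Data.List.Relation.Unary.Unique.DecPropositional ℕ._≟_ using (Unique; unique?)
open import Data.List.Relation.Binary.Permutation.Propositional using (_↭_; ↭-sym; ↭⇒↭ₛ)
open import Data.List.Relation.Binary.Permutation.Propositional.Properties using (↭-length)
import Data.List.Relation.Binary.Permutation.Setoid.Properties
open import Data.Maybe using (just; nothing)
open import Data.Product using (_×_; _,_; proj₁; proj₂)
open import Data.Sum using (_⊎_; inj₁; inj₂)
open import Function using (_∘_; id)
open import Relation.Nullary using (Dec; yes; no; ¬_; contradiction)
open import Relation.Binary.Definitions using (WeaklyDecidable; Tri; tri<; tri≈; tri>)
import Relation.Binary.PropositionalEquality as ≡
import Relation.Binary.Reasoning.Setoid
open import Algebra.Solver.Ring.AlmostCommutativeRing
  using (fromCommutativeRing; _-Raw-AlmostCommutative⟶_; Induced-equivalence)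
import Algebra.Solver.Ring
import Algebra.Properties.Ring
import Algebra.Properties.AbelianGroup
import Algebra.Properties.Semiring.Sum

-- Let χᵢ(n) = i if i ∣ n and 0 otherwise.  Integer combinations of the χᵢ satisfy the
-- congruence because ∑_{m∣n} μ(n/m) χᵢ(m) is i ∑_{e∣n/i} μ(e), and they are closed under
-- products (χᵢ χⱼ = gcd(i,j) χ_lcm(i,j)) and under dilations n ↦ n s.
-- The power sums n ↦ ∑ αⱼⁿ form such a combination: writing the integral series
-- ∏ (1 - αⱼ x) as an infinite product ∏ (1 - xⁱ)^{cᵢ} with cᵢ ∈ ℤ and taking logarithmic
-- derivatives gives ∑ⱼ αⱼⁿ = ∑ᵢ cᵢ χᵢ(n).
-- Finally the discriminant is an integer polynomial in power sums, without denominators: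
-- Δ(β) = ∑ ∏ᵢ xᵢ^(i-1) ∏_{i<j} (xⱼ - xᵢ), summed over all x₁, …, x_d ∈ {β₁, …, β_d}.

-- `R` is an arbitrary commutative ring: it may have torsion and zero divisors, and `fromℤ` need not
-- be injective. An element of `R` thus determines no integer, and integers cannot be cancelled. So
-- the integers are produced first, as a lift built from the coefficients of P alone, and only their
-- images are compared with expressions in the roots. Newton's identities are kept as f τ = -f′,
-- which is solvable over ℤ and has one solution over `R` because f has constant term 1. Summing the
-- squared Vandermonde product over all d-tuples would give d! Δ; with one of its two factors
-- replaced by the diagonal monomial, the signed sum over permutations rebuilds that factor exactly
-- once. After expansion every monomial sums to a product of power sums of the αⱼⁿ, and the e-th
-- power sum of the αⱼⁿ is the power sum of the αⱼ with exponent n e; this is where dilations enter.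
-- Since only m ≤ n occur, the infinite product is needed only up to a finite degree.

-- The image of ℤ in a commutative ring.

module IntegerImage {c ℓ : Level} (R : CommutativeRing c ℓ) where
  open CommutativeRing R
  open Algebra.Properties.Ring ring using (-‿distribˡ-*; -0#≈0#)
  open Algebra.Properties.AbelianGroup +-abelianGroup using (⁻¹-∙-comm; ⁻¹-involutive)
  open Relation.Binary.Reasoning.Setoid setoid

  fromℕ-+ : ∀ m n → fromℕ R (m ℕ.+ n) ≈ fromℕ R m + fromℕ R n
  fromℕ-+ zero    n = sym (+-identityˡ _)
  fromℕ-+ (suc m) n = trans (+-congˡ (fromℕ-+ m n)) (sym (+-assoc _ _ _))

  fromℤ-⊖ : ∀ m n → fromℤ R (m ℤ.⊖ n) ≈ fromℕ R m - fromℕ R n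
  fromℤ-⊖ zero    zero    = sym (-‿inverseʳ 0#)
  fromℤ-⊖ zero    (suc n) = sym (+-identityˡ _)
  fromℤ-⊖ (suc m) zero    = sym (trans (+-congˡ -0#≈0#) (+-identityʳ _))
  fromℤ-⊖ (suc m) (suc n) = begin
    fromℤ R (suc m ℤ.⊖ suc n)              ≡⟨ ≡.cong (fromℤ R) (ℤₚ.[1+m]⊖[1+n]≡m⊖n m n) ⟩
    fromℤ R (m ℤ.⊖ n)                      ≈⟨ fromℤ-⊖ m n ⟩
    fromℕ R m - fromℕ R n                  ≈⟨ +-congʳ (+-identityʳ _) ⟨
    (fromℕ R m + 0#) - fromℕ R n           ≈⟨ +-congʳ (+-congˡ (-‿inverseʳ 1#)) ⟨
    (fromℕ R m + (1# - 1#)) - fromℕ R n    ≈⟨ +-congʳ (+-assoc _ _ _) ⟨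
    ((fromℕ R m + 1#) - 1#) - fromℕ R n    ≈⟨ +-assoc _ _ _ ⟩
    (fromℕ R m + 1#) + (- 1# - fromℕ R n)  ≈⟨ +-cong (+-comm _ _) (⁻¹-∙-comm _ _) ⟩
    (1# + fromℕ R m) - (1# + fromℕ R n)    ∎

  fromℤ-neg : ∀ i → fromℤ R (ℤ.- i) ≈ - fromℤ R i
  fromℤ-neg (+ zero)  = sym -0#≈0#
  fromℤ-neg (+ suc n) = refl
  fromℤ-neg -[1+ n ]  = sym (⁻¹-involutive _)

  fromℤ-+ : ∀ i j → fromℤ R (i ℤ.+ j) ≈ fromℤ R i + fromℤ R j
  fromℤ-+ (+ m)    (+ n)    = fromℕ-+ m n
  fromℤ-+ (+ m)    -[1+ n ] = fromℤ-⊖ m (suc n)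
  fromℤ-+ -[1+ m ] (+ n)    = trans (fromℤ-⊖ n (suc m)) (+-comm _ _)
  fromℤ-+ -[1+ m ] -[1+ n ] = begin
    - fromℕ R (suc (suc (m ℕ.+ n)))      ≡⟨ ≡.cong (λ k → - fromℕ R (suc k)) (ℕₚ.+-suc m n) ⟨
    - fromℕ R (suc m ℕ.+ suc n)          ≈⟨ -‿cong (fromℕ-+ (suc m) (suc n)) ⟩
    - (fromℕ R (suc m) + fromℕ R (suc n)) ≈⟨ ⁻¹-∙-comm _ _ ⟨
    - fromℕ R (suc m) - fromℕ R (suc n)  ∎

  fromℤ-*ₙ : ∀ m j → fromℤ R ((+ m) ℤ.* j) ≈ fromℕ R m * fromℤ R j
  fromℤ-*ₙ zero    j = trans (reflexive (≡.cong (fromℤ R) (ℤₚ.*-zeroˡ j))) (sym (zeroˡ _))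
  fromℤ-*ₙ (suc m) j = begin
    fromℤ R ((+ suc m) ℤ.* j)                     ≡⟨ ≡.cong (fromℤ R) (ℤₚ.suc-* (+ m) j) ⟩
    fromℤ R (j ℤ.+ (+ m) ℤ.* j)                   ≈⟨ fromℤ-+ j _ ⟩
    fromℤ R j + fromℤ R ((+ m) ℤ.* j)             ≈⟨ +-cong (sym (*-identityˡ _)) (fromℤ-*ₙ m j) ⟩
    1# * fromℤ R j + fromℕ R m * fromℤ R j        ≈⟨ distribʳ _ _ _ ⟨
    (1# + fromℕ R m) * fromℤ R j                  ∎

  fromℤ-* : ∀ i j → fromℤ R (i ℤ.* j) ≈ fromℤ R i * fromℤ R j
  fromℤ-* (+ m)    j = fromℤ-*ₙ m j
  fromℤ-* -[1+ m ] j = begin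
    fromℤ R (-[1+ m ] ℤ.* j)        ≡⟨ ≡.cong (fromℤ R) (ℤₚ.neg-distribˡ-* (+ suc m) j) ⟨
    fromℤ R (ℤ.- ((+ suc m) ℤ.* j)) ≈⟨ fromℤ-neg ((+ suc m) ℤ.* j) ⟩
    - fromℤ R ((+ suc m) ℤ.* j)     ≈⟨ -‿cong (fromℤ-*ₙ (suc m) j) ⟩
    - (fromℕ R (suc m) * fromℤ R j) ≈⟨ -‿distribˡ-* _ _ ⟩
    - fromℕ R (suc m) * fromℤ R j   ∎

  fromℤ-1 : fromℤ R (+ 1) ≈ 1#
  fromℤ-1 = +-identityʳ 1#

  private
    morphism : CommutativeRing.rawRing ℤₚ.+-*-commutativeRing
                 -Raw-AlmostCommutative⟶ fromCommutativeRing R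
    morphism = record
      { ⟦_⟧    = fromℤ R
      ; +-homo = fromℤ-+
      ; *-homo = fromℤ-*
      ; -‿homo = fromℤ-neg
      ; 0-homo = refl
      ; 1-homo = fromℤ-1
      }

    _coeff≟_ : WeaklyDecidable (Induced-equivalence morphism)
    i coeff≟ j with i ℤ.≟ j
    ... | yes i≡j = just (reflexive (≡.cong (fromℤ R) i≡j))
    ... | no  _   = nothing

  -- Coefficients are integers because their equality is decidable, whereas equality in `R` need not
  -- be.
  module Solver = Algebra.Solver.Ring
    (CommutativeRing.rawRing ℤₚ.+-*-commutativeRing) (fromCommutativeRing R) morphism _coeff≟_

-- The discriminant as a sum over tuples of roots.

module Discriminant {c ℓ : Level} (R : CommutativeRing c ℓ) where
  open CommutativeRing R
  open Algebra.Properties.Semiring.Sum semiring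
  open IntegerImage R
  open Solver using (solve; con; _:=_; _:+_; _:*_; _:-_)
  open Relation.Binary.Reasoning.Setoid setoid

  sum-zero : ∀ {n} (f : Fin n → Carrier) → (∀ i → f i ≈ 0#) → sum f ≈ 0#
  sum-zero {n} f f≈0 = trans (sum-cong-≋ f≈0) (sum-replicate-zero n)

  -- The terms at (x, y) and (y, x) cancel. The diagonal needs its own hypothesis: where 2 is not
  -- cancellable, `anti x x` does not give `g x x ≈ 0#`.
  sum-antisymmetric : ∀ {n} (g : Fin n → Fin n → Carrier) →
    (∀ x → g x x ≈ 0#) → (∀ x y → g x y + g y x ≈ 0#) → sum (λ x → sum (g x)) ≈ 0#
  sum-antisymmetric {zero}  g diag anti = refl
  sum-antisymmetric {suc n} g diag anti = begin
    (g₀₀ + row) + sum (λ x → g (Fin.suc x) Fin.zero + sum (λ y → g (Fin.suc x) (Fin.suc y)))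
      ≈⟨ +-cong (trans (+-congʳ (diag Fin.zero)) (+-identityˡ _)) (∑-distrib-+ (λ x → g (Fin.suc x) Fin.zero) _) ⟩
    row + (col + sum (λ x → sum (λ y → g (Fin.suc x) (Fin.suc y))))
      ≈⟨ +-congˡ (+-congˡ (sum-antisymmetric (λ x y → g (Fin.suc x) (Fin.suc y))
           (diag ∘ Fin.suc) (λ x y → anti (Fin.suc x) (Fin.suc y)))) ⟩
    row + (col + 0#)
      ≈⟨ +-congˡ (+-identityʳ _) ⟩
    row + col
      ≈⟨ ∑-distrib-+ (λ y → g Fin.zero (Fin.suc y)) _ ⟨
    sum (λ y → g Fin.zero (Fin.suc y) + g (Fin.suc y) Fin.zero)
      ≈⟨ sum-zero _ (λ y → anti Fin.zero (Fin.suc y)) ⟩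
    0# ∎
    where
    g₀₀ = g Fin.zero Fin.zero
    row = sum (λ y → g Fin.zero (Fin.suc y))
    col = sum (λ x → g (Fin.suc x) Fin.zero)

  prodFin-cong : ∀ d {f g : Fin d → Carrier} → (∀ i → f i ≈ g i) → prodFin R d f ≈ prodFin R d g
  prodFin-cong zero    f≈g = refl
  prodFin-cong (suc d) f≈g = *-cong (f≈g Fin.zero) (prodFin-cong d (f≈g ∘ Fin.suc))

  prodFin-zero : ∀ d (f : Fin d → Carrier) i → f i ≈ 0# → prodFin R d f ≈ 0#
  prodFin-zero (suc d) f Fin.zero    fi≈0 = trans (*-congʳ fi≈0) (zeroˡ _)
  prodFin-zero (suc d) f (Fin.suc i) fi≈0 =
    trans (*-congˡ (prodFin-zero d (f ∘ Fin.suc) i fi≈0)) (zeroʳ _)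

  prodFin-* : ∀ d (f g : Fin d → Carrier) →
    prodFin R d (λ i → f i * g i) ≈ prodFin R d f * prodFin R d g
  prodFin-* zero    f g = sym (*-identityˡ 1#)
  prodFin-* (suc d) f g = trans (*-congˡ (prodFin-* d (f ∘ Fin.suc) (g ∘ Fin.suc)))
    (solve 4 (λ a b x y → (a :* b) :* (x :* y) := (a :* x) :* (b :* y)) refl _ _ _ _)

  -- ∑ over all (x₁,…,xₘ) of  ∏ᵢ b(xᵢ)^(k+i-1) u(xᵢ) · ∏_{i<j} (b(xⱼ) - b(xᵢ)),
  -- the Vandermonde factors being absorbed in the weight u as the sums are nested.
  vandermondeSum : ∀ {D} (b : Fin D → Carrier) (m k : ℕ) (u : Fin D → Carrier) → Carrier
  vandermondeSum b zero    k u = 1#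
  vandermondeSum b (suc m) k u =
    sum (λ x → (pow R (b x) k * u x) * vandermondeSum b m (suc k) (λ y → (b y - b x) * u y))

  vandermondeSum-cong : ∀ {D} (b : Fin D → Carrier) m k {u v : Fin D → Carrier} →
    (∀ x → u x ≈ v x) → vandermondeSum b m k u ≈ vandermondeSum b m k v
  vandermondeSum-cong b zero    k u≈v = refl
  vandermondeSum-cong b (suc m) k u≈v = sum-cong-≋ (λ x →
    *-cong (*-congˡ (u≈v x)) (vandermondeSum-cong b m (suc k) (λ y → *-congˡ (u≈v y))))

  -- Subtracting c times each row from the next one in the underlying determinant.
  rowReduction : ∀ {D} (b : Fin D → Carrier) m k (u : Fin D → Carrier) (c : Carrier) →
    vandermondeSum b (suc m) k u ≈
    sum (λ x → (pow R (b x) k * u x) * vandermondeSum b m k (λ y → (b y - c) * ((b y - b x) * u y)))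
  rowReduction b zero    k u c = refl
  rowReduction {D} b (suc m) k u c = begin
    sum (λ x → X x * vandermondeSum b (suc m) (suc k) (v x))
      ≈⟨ sum-cong-≋ (λ x → *-congˡ (rowReduction b m (suc k) (v x) c)) ⟩
    sum (λ x → X x * sum (λ y → (pow R (b y) (suc k) * v x y) * H x y))
      ≈⟨ sum-cong-≋ (λ x → trans (*-distribˡ-sum (X x) (λ y → (pow R (b y) (suc k) * v x y) * H x y))
           (trans (sum-cong-≋ (λ y → split x y)) (∑-distrib-+ (reduced x) (excess x)))) ⟩
    sum (λ x → sum (reduced x) + sum (excess x))
      ≈⟨ ∑-distrib-+ (λ x → sum (reduced x)) (λ x → sum (excess x)) ⟩
    sum (λ x → sum (reduced x)) + sum (λ x → sum (excess x))
      ≈⟨ trans (+-congˡ (sum-antisymmetric excess diag anti)) (+-identityʳ _) ⟩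
    sum (λ x → sum (reduced x))
      ≈⟨ sum-cong-≋ (λ x → sym (*-distribˡ-sum (X x) (λ y → (pow R (b y) k * ((b y - c) * v x y)) * H x y))) ⟩
    sum (λ x → X x * sum (λ y → (pow R (b y) k * ((b y - c) * v x y)) * H x y))
      ≈⟨ sum-cong-≋ (λ x → *-congˡ {x = X x} (sum-cong-≋ (λ y → *-congˡ (vandermondeSum-cong b m (suc k)
           (λ z → exchange (b z - c) (b z - b y) (v x z)))))) ⟩
    sum (λ x → X x * vandermondeSum b (suc m) k (λ y → (b y - c) * v x y)) ∎
    where
    X : Fin D → Carrier
    X x = pow R (b x) k * u x
    v : Fin D → Fin D → Carrier
    v x y = (b y - b x) * u y
    H reduced excess : Fin D → Fin D → Carrier
    H x y = vandermondeSum b m (suc k) (λ z → (b z - c) * ((b z - b y) * v x z))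
    -- Comes from b_y^(k+1) = b_y^k (b_y - c) + c b_y^k. In the `excess` part x and y carry the same
    -- power of b and `H` is symmetric, so swapping them only flips the sign of b_y - b_x: a
    -- determinant with two equal rows.
    reduced x y = X x * ((pow R (b y) k * ((b y - c) * v x y)) * H x y)
    excess x y = (c * (X x * X y)) * ((b y - b x) * H x y)
    exchange : ∀ p q r → p * (q * r) ≈ q * (p * r)
    exchange = solve 3 (λ p q r → p :* (q :* r) := q :* (p :* r)) refl
    H-sym : ∀ x y → H x y ≈ H y x
    H-sym x y = vandermondeSum-cong b m (suc k) (λ z → *-congˡ (exchange _ _ _))
    split : ∀ x y → X x * ((pow R (b y) (suc k) * v x y) * H x y) ≈ reduced x y + excess x y
    split x y = solve 7 (λ X p bx by u h c →
        X :* (((by :* p) :* ((by :- bx) :* u)) :* h) :=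
        X :* ((p :* ((by :- c) :* ((by :- bx) :* u))) :* h) :+ (c :* (X :* (p :* u))) :* ((by :- bx) :* h))
      refl (X x) (pow R (b y) k) (b x) (b y) (u y) (H x y) c
    diag : ∀ x → excess x x ≈ 0#
    diag x = solve 3 (λ p bx h → p :* ((bx :- bx) :* h) := con (+ 0)) refl (c * (X x * X x)) (b x) (H x x)
    anti : ∀ x y → excess x y + excess y x ≈ 0#
    anti x y = trans (+-congˡ (*-congˡ (*-congˡ (H-sym y x))))
      (solve 6 (λ c X Y bx by h →
          (c :* (X :* Y)) :* ((by :- bx) :* h) :+ (c :* (Y :* X)) :* ((bx :- by) :* h) := con (+ 0))
        refl c (X x) (X y) (b x) (b y) (H x y))

  -- A weight that vanishes at an index still vanishes there at every deeper level, since nesting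
  -- only multiplies the weight by further factors.
  vandermondeSum-restrict : ∀ {D} (b : Fin (suc D) → Carrier) m k (u : Fin (suc D) → Carrier) →
    u Fin.zero ≈ 0# → vandermondeSum b m k u ≈ vandermondeSum (b ∘ Fin.suc) m k (u ∘ Fin.suc)
  vandermondeSum-restrict b zero    k u u₀≈0 = refl
  vandermondeSum-restrict b (suc m) k u u₀≈0 = trans
    (+-cong
      (trans (*-congʳ (trans (*-congˡ u₀≈0) (zeroʳ _))) (zeroˡ _))
      (sum-cong-≋ (λ x → *-congˡ {x = pow R (b (Fin.suc x)) k * u (Fin.suc x)} (vandermondeSum-restrict b m (suc k)
        (λ y → (b y - b (Fin.suc x)) * u y)
        (trans (*-congˡ u₀≈0) (zeroʳ _))))))
    (+-identityˡ _)

  -- Reduce by c = b₀, which kills the index 0 in the inner sums; then the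
  -- induction hypothesis kills every outer index but 0.
  vandermondeSum≈discRoots : ∀ D (b u : Fin D → Carrier) →
    vandermondeSum b D 0 u ≈ prodFin R D u * discRoots R D b
  vandermondeSum≈discRoots zero    b u = sym (*-identityˡ 1#)
  vandermondeSum≈discRoots (suc D) b u = begin
    vandermondeSum b (suc D) 0 u
      ≈⟨ rowReduction b D 0 u b₀ ⟩
    sum (λ x → (1# * u x) * vandermondeSum b D 0 (λ y → (b y - b₀) * ((b y - b x) * u y)))
      ≈⟨ sum-cong-≋ (λ x → *-congˡ {x = 1# * u x} (trans
           (vandermondeSum-restrict b D 0 (λ y → (b y - b₀) * ((b y - b x) * u y)) (trans (*-congʳ (-‿inverseʳ b₀)) (zeroˡ _)))
           (vandermondeSum≈discRoots D b′ (w x)))) ⟩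
    sum (λ x → (1# * u x) * (prodFin R D (w x) * discRoots R D b′))
      ≈⟨ +-congˡ (sum-zero _ (λ z → trans (*-congˡ (trans (*-congʳ (prodFin-zero D (w (Fin.suc z)) z
           (trans (*-congˡ (trans (*-congʳ (-‿inverseʳ (b′ z))) (zeroˡ _))) (zeroʳ _)))) (zeroˡ _))) (zeroʳ _))) ⟩
    (1# * u Fin.zero) * (prodFin R D (w Fin.zero) * discRoots R D b′) + 0#
      ≈⟨ trans (+-identityʳ _) (*-cong (*-identityˡ _) (*-congʳ (trans
           (prodFin-cong D (λ y → squared (b′ y) b₀ (u (Fin.suc y)))) (prodFin-* D _ _)))) ⟩
    u Fin.zero * ((prodFin R D (u ∘ Fin.suc) * prodFin R D (λ k → pow R (b₀ - b′ k) 2)) * discRoots R D b′)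
      ≈⟨ solve 4 (λ a p q d → a :* ((p :* q) :* d) := (a :* p) :* (q :* d)) refl _ _ _ _ ⟩
    (u Fin.zero * prodFin R D (u ∘ Fin.suc)) * (prodFin R D (λ k → pow R (b₀ - b′ k) 2) * discRoots R D b′) ∎
    where
    b₀ = b Fin.zero
    b′ = b ∘ Fin.suc
    w : Fin (suc D) → Fin D → Carrier
    w x y = (b′ y - b₀) * ((b′ y - b x) * u (Fin.suc y))
    squared : ∀ y x t → (y - x) * ((y - x) * t) ≈ t * pow R (x - y) 2
    squared y x t = trans (solve 3 (λ y x t → (y :- x) :* ((y :- x) :* t) := t :* ((x :- y) :* (x :- y))) refl y x t)
      (*-congˡ (*-congˡ (sym (*-identityʳ _))))

-- Power series and Newton's identities without division.

module NewtonIdentities {c ℓ : Level} (R : CommutativeRing c ℓ) where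
  open CommutativeRing R hiding (zero)
  open Algebra.Properties.Ring ring using (-0#≈0#; +-cancelˡ)
  open Algebra.Properties.Semiring.Sum semiring using (sum)
  open IntegerImage R
  open Solver using (solve; _:=_; _:+_; _:*_; _:-_; :-_)
  open Relation.Binary.Reasoning.Setoid setoid

  Series : Set c
  Series = ℕ → Carrier

  -- The Cauchy product ∑ f(n-i) g(i), unrolled along g so that no indices are subtracted.
  conv : Series → Series → Series
  conv f g zero    = f 0 * g 0
  conv f g (suc n) = f (suc n) * g 0 + conv f (g ∘ suc) n

  shift : ℕ → Series → Series
  shift zero    f n       = f n
  shift (suc k) f zero    = 0#
  shift (suc k) f (suc n) = shift k f n

  one : Series
  one zero    = 1#
  one (suc _) = 0#

  conv-cong : ∀ n {f f′ g g′ : Series} → (∀ i → f i ≈ f′ i) → (∀ i → g i ≈ g′ i) →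
    conv f g n ≈ conv f′ g′ n
  conv-cong zero    f≈f′ g≈g′ = *-cong (f≈f′ 0) (g≈g′ 0)
  conv-cong (suc n) f≈f′ g≈g′ =
    +-cong (*-cong (f≈f′ (suc n)) (g≈g′ 0)) (conv-cong n f≈f′ (g≈g′ ∘ suc))

  conv-zeroʳ : ∀ f n → conv f (λ _ → 0#) n ≈ 0#
  conv-zeroʳ f zero    = zeroʳ _
  conv-zeroʳ f (suc n) = trans (+-cong (zeroʳ _) (conv-zeroʳ f n)) (+-identityˡ 0#)

  conv-+ʳ : ∀ f g h n → conv f (λ i → g i + h i) n ≈ conv f g n + conv f h n
  conv-+ʳ f g h zero    = distribˡ _ _ _
  conv-+ʳ f g h (suc n) = trans (+-congˡ (conv-+ʳ f (g ∘ suc) (h ∘ suc) n))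
    (solve 5 (λ a x y p q → a :* (x :+ y) :+ (p :+ q) := (a :* x :+ p) :+ (a :* y :+ q)) refl _ _ _ _ _)

  conv-*ʳ : ∀ f a g n → conv f (λ i → a * g i) n ≈ a * conv f g n
  conv-*ʳ f a g zero    = solve 3 (λ f a g → f :* (a :* g) := a :* (f :* g)) refl _ _ _
  conv-*ʳ f a g (suc n) = trans (+-congˡ (conv-*ʳ f a (g ∘ suc) n))
    (solve 4 (λ f a g p → f :* (a :* g) :+ a :* p := a :* (f :* g :+ p)) refl _ _ _ _)

  conv-shiftʳ : ∀ k f g n → conv f (shift k g) n ≈ shift k (conv f g) n
  conv-shiftʳ zero    f g n       = refl
  conv-shiftʳ (suc k) f g zero    = zeroʳ _
  conv-shiftʳ (suc k) f g (suc n) =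
    trans (+-cong (zeroʳ _) (conv-shiftʳ k f g n)) (+-identityˡ _)

  conv-shiftˡ : ∀ k f g n → conv (shift k f) g n ≈ shift k (conv f g) n
  conv-shiftˡ zero    f g n       = refl
  conv-shiftˡ (suc k) f g zero    = zeroˡ _
  conv-shiftˡ (suc k) f g (suc n) = trans (unshift g n) (conv-shiftˡ k f g n)
    where
    unshift : ∀ g n → conv (shift (suc k) f) g (suc n) ≈ conv (shift k f) g n
    unshift g zero    = trans (+-congˡ (zeroˡ _)) (+-identityʳ _)
    unshift g (suc n) = +-congˡ (unshift (g ∘ suc) n)

  conv-oneʳ : ∀ f n → conv f one n ≈ f n
  conv-oneʳ f zero    = *-identityʳ _
  conv-oneʳ f (suc n) = trans (+-cong (*-identityʳ _) (conv-zeroʳ f n)) (+-identityʳ _)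

  shift-cong : ∀ k {f g : Series} → (∀ i → f i ≈ g i) → ∀ n → shift k f n ≈ shift k g n
  shift-cong zero    f≈g n       = f≈g n
  shift-cong (suc k) f≈g zero    = refl
  shift-cong (suc k) f≈g (suc n) = shift-cong k f≈g n

  -- Multiplication by 1 - a xᵏ.
  twist : Carrier → ℕ → Series → Series
  twist a k f n = f n - a * shift k f n

  conv-twistˡ : ∀ a k f g n → conv (twist a k f) g n ≈ twist a k (conv f g) n
  conv-twistˡ a k f g n = trans (expand g n) (+-congˡ (-‿cong (*-congˡ (conv-shiftˡ k f g n))))
    where
    expand : ∀ g n → conv (twist a k f) g n ≈ conv f g n - a * conv (shift k f) g n
    expand g zero    = solve 4 (λ f a s g → (f :- a :* s) :* g := f :* g :- a :* (s :* g)) refl _ _ _ _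
    expand g (suc n) = trans (+-congˡ (expand (g ∘ suc) n))
      (solve 6 (λ f a s g p q → (f :- a :* s) :* g :+ (p :- a :* q) :=
                                (f :* g :+ p) :- a :* (s :* g :+ q)) refl _ _ _ _ _ _)

  -derivative : Series → Series
  -derivative f n = - (fromℕ R (suc n) * f (suc n))

  -- If f = ∏ (1 - αⱼ x), then τ n = ∑ αⱼⁿ⁺¹ :  the index is one less than the exponent.
  IsNewton : Series → Series → Set ℓ
  IsNewton f τ = ∀ n → conv f τ n ≈ -derivative f n

  IsNewton-one : IsNewton one (λ _ → 0#)
  IsNewton-one n = trans (conv-zeroʳ one n) (sym (trans (-‿cong (zeroʳ _)) -0#≈0#))

  IsNewton-cong : ∀ {f g τ υ} → (∀ n → f n ≈ g n) → (∀ n → τ n ≈ υ n) → IsNewton f τ → IsNewton g υ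
  IsNewton-cong f≈g τ≈υ newton n = trans (sym (conv-cong n f≈g τ≈υ))
    (trans (newton n) (-‿cong (*-congˡ (f≈g (suc n)))))

  -- (xᵏ⁺¹ f)′ = (k+1) xᵏ f + xᵏ⁺¹ f′
  shift-derivative : ∀ k f n → fromℕ R (suc n) * shift k f n ≈
    fromℕ R (suc k) * shift k f n - shift (suc k) (-derivative f) n
  shift-derivative zero f zero = sym (trans (+-congˡ -0#≈0#) (+-identityʳ _))
  shift-derivative zero f (suc n) =
    trans (*-congʳ {x = f (suc n)} refl) (trans (distribʳ _ 1# (fromℕ R (suc n)))
      (+-cong (*-congʳ (sym (+-identityʳ 1#)))
        (solve 1 (λ p → p := :- (:- p)) refl (fromℕ R (suc n) * f (suc n)))))
  shift-derivative (suc k) f zero = trans (zeroʳ _)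
    (sym (trans (+-cong (zeroʳ _) -0#≈0#) (+-identityˡ 0#)))
  shift-derivative (suc k) f (suc n) =
    trans (distribʳ _ 1# (fromℕ R (suc n))) (trans (+-congˡ (shift-derivative k f n))
      (trans (sym (+-assoc _ _ _)) (+-congʳ (sym (distribʳ _ 1# (fromℕ R (suc k)))))))

  -- The hypothesis on χ says that (1 - a xᵏ⁺¹) χ = a (k+1) xᵏ, i.e. that χ is minus
  -- the logarithmic derivative of 1 - a xᵏ⁺¹.
  IsNewton-twist : ∀ a k {f τ} (χ : Series) →
    (∀ n → χ n ≈ a * shift (suc k) χ n + a * (fromℕ R (suc k) * shift k one n)) →
    IsNewton f τ → IsNewton (twist a (suc k) f) (λ n → τ n + χ n)
  IsNewton-twist a k {f} {τ} χ χ-eq newton n = begin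
    conv (twist a (suc k) f) (λ i → τ i + χ i) n
      ≈⟨ conv-+ʳ _ τ χ n ⟩
    conv (twist a (suc k) f) τ n + conv (twist a (suc k) f) χ n
      ≈⟨ +-cong (conv-twistˡ a (suc k) f τ n) (conv-twistˡ a (suc k) f χ n) ⟩
    (conv f τ n - a * shift (suc k) (conv f τ) n) + (conv f χ n - a * shift (suc k) (conv f χ) n)
      ≈⟨ +-cong (+-cong (newton n) (-‿cong (*-congˡ (shift-cong (suc k) newton n)))) (+-congʳ conv-χ) ⟩
    (d - a * D) + ((a * shift (suc k) (conv f χ) n + a * (K * s)) - a * shift (suc k) (conv f χ) n)
      ≈⟨ solve 6 (λ d a D q K s → (d :- a :* D) :+ ((a :* q :+ a :* (K :* s)) :- a :* q) :=
                                  d :+ a :* (K :* s :- D)) refl d a D _ K s ⟩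
    d + a * (K * s - D)
      ≈⟨ +-congˡ (*-congˡ (shift-derivative k f n)) ⟨
    d + a * (fromℕ R (suc n) * s)
      ≈⟨ solve 4 (λ n f a s → :- (n :* f) :+ a :* (n :* s) := :- (n :* (f :- a :* s))) refl
           (fromℕ R (suc n)) (f (suc n)) a s ⟩
    -derivative (twist a (suc k) f) n ∎
    where
    s = shift k f n
    K = fromℕ R (suc k)
    d = -derivative f n
    D = shift (suc k) (-derivative f) n
    conv-χ : conv f χ n ≈ a * shift (suc k) (conv f χ) n + a * (K * s)
    conv-χ = begin
      conv f χ n
        ≈⟨ conv-cong n (λ _ → refl) χ-eq ⟩
      conv f (λ i → a * shift (suc k) χ i + a * (K * shift k one i)) n
        ≈⟨ conv-+ʳ f _ _ n ⟩
      conv f (λ i → a * shift (suc k) χ i) n + conv f (λ i → a * (K * shift k one i)) n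
        ≈⟨ +-cong (trans (conv-*ʳ f a _ n) (*-congˡ (conv-shiftʳ (suc k) f χ n)))
                  (trans (conv-*ʳ f a _ n) (*-congˡ (trans (conv-*ʳ f K _ n) (*-congˡ
                    (trans (conv-shiftʳ k f one n) (shift-cong k (conv-oneʳ f) n)))))) ⟩
      a * shift (suc k) (conv f χ) n + a * (K * s) ∎

  -- A series with constant term 1 is cancellable over any ring: degree 0 gives `τ 0 ≈ υ 0`, and
  -- removing that term leaves the same problem for the shifted series. The bounds by n allow f and
  -- g to agree only up to a finite degree.
  conv-cancel : ∀ n {f g τ υ} → f 0 ≈ 1# → (∀ i → i ℕ.≤ n → f i ≈ g i) →
    (∀ i → i ℕ.≤ n → conv f τ i ≈ conv g υ i) → τ n ≈ υ n
  conv-cancel zero {f} {g} {τ} {υ} f₀≈1 f≈g eq = begin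
    τ 0       ≈⟨ *-identityˡ _ ⟨
    1# * τ 0  ≈⟨ *-congʳ f₀≈1 ⟨
    f 0 * τ 0 ≈⟨ eq 0 z≤n ⟩
    g 0 * υ 0 ≈⟨ *-congʳ (trans (sym (f≈g 0 z≤n)) f₀≈1) ⟩
    1# * υ 0  ≈⟨ *-identityˡ _ ⟩
    υ 0       ∎
  conv-cancel (suc n) {f} {g} {τ} {υ} f₀≈1 f≈g eq =
    conv-cancel n f₀≈1 (λ i i≤n → f≈g i (ℕₚ.m≤n⇒m≤1+n i≤n)) λ i i≤n →
      +-cancelˡ (f (suc i) * τ 0) _ _ (begin
        f (suc i) * τ 0 + conv f (τ ∘ suc) i  ≈⟨ eq (suc i) (s≤s i≤n) ⟩
        g (suc i) * υ 0 + conv g (υ ∘ suc) i  ≈⟨ +-congʳ (*-cong (f≈g (suc i) (s≤s i≤n)) τ₀≈υ₀) ⟨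
        f (suc i) * τ 0 + conv g (υ ∘ suc) i  ∎)
    where
    τ₀≈υ₀ : τ 0 ≈ υ 0
    τ₀≈υ₀ = conv-cancel zero {f} {g} {τ} {υ} f₀≈1 (λ { _ z≤n → f≈g 0 z≤n }) (λ { _ z≤n → eq 0 z≤n })

  -- The quotient g / f of power series, for f with constant term 1.
  quot : Series → Series → Series
  quot f g zero    = g 0
  quot f g (suc n) = quot f (λ i → g (suc i) - g 0 * f (suc i)) n

  conv-quot : ∀ f g → f 0 ≈ 1# → ∀ n → conv f (quot f g) n ≈ g n
  conv-quot f g f₀≈1 zero    = trans (*-congʳ f₀≈1) (*-identityˡ _)
  conv-quot f g f₀≈1 (suc n) = trans (+-congˡ (conv-quot f _ f₀≈1 n))
    (solve 3 (λ p q r → p :* q :+ (r :- q :* p) := r) refl (f (suc n)) (g 0) (g (suc n)))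

  -- For P of degree d this is x^d P(1/x), which turns ∏ (x - αⱼ) into ∏ (1 - αⱼ x).
  reversed : ∀ {n} → Vec Carrier n → Series
  reversed         []       i = 0#
  reversed {suc n} (x ∷ xs) i = reversed xs i + x * shift n one i

  reversed-cong : ∀ {n} {p q : Vec Carrier n} → Pointwise _≈_ p q → ∀ i → reversed p i ≈ reversed q i
  reversed-cong []          i = refl
  reversed-cong (x≈y ∷ p≈q) i = +-cong (reversed-cong p≈q i) (*-congʳ x≈y)

  reversed-∷ʳ : ∀ {n} (p : Vec Carrier n) y i →
    reversed (p ∷ʳ y) i ≈ shift 1 (reversed p) i + y * one i
  reversed-∷ʳ []      y zero    = refl
  reversed-∷ʳ []      y (suc i) = refl
  reversed-∷ʳ (x ∷ p) y zero    = trans (+-congˡ (zeroʳ x)) (trans (+-identityʳ _) (reversed-∷ʳ p y zero))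
  reversed-∷ʳ {suc n} (x ∷ p) y (suc i) = trans (+-congʳ (reversed-∷ʳ p y (suc i)))
    (solve 3 (λ r q s → (r :+ q) :+ s := (r :+ s) :+ q) refl _ _ _)

  reversed-map : ∀ {n} a (p : Vec Carrier n) i → reversed (Vec.map (a *_) p) i ≈ a * reversed p i
  reversed-map a []      i = sym (zeroʳ a)
  reversed-map a (x ∷ p) i = trans (+-congʳ (reversed-map a p i))
    (solve 4 (λ a r x s → a :* r :+ (a :* x) :* s := a :* (r :+ x :* s)) refl _ _ _ _)

  reversed-zipWith : ∀ {n} (p q : Vec Carrier n) i →
    reversed (Vec.zipWith _-_ p q) i ≈ reversed p i - reversed q i
  reversed-zipWith []      []      i = sym (-‿inverseʳ 0#)
  reversed-zipWith (x ∷ p) (y ∷ q) i = trans (+-congʳ (reversed-zipWith p q i))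
    (solve 5 (λ p q x y s → (p :- q) :+ (x :- y) :* s := (p :+ x :* s) :- (q :+ y :* s)) refl _ _ _ _ _)

  -- Reversal exchanges the two ends: the zero put in front of p has no effect, while the zero
  -- appended to a p becomes a shift. Thus x - a turns into 1 - a x.
  reversed-mulLinear : ∀ {n} (p : Vec Carrier (suc n)) a i →
    reversed (mulLinear R p a) i ≈ twist a 1 (reversed p) i
  reversed-mulLinear p a i = begin
    reversed (mulLinear R p a) i
      ≈⟨ reversed-zipWith (0# ∷ p) (Vec.map (a *_) p ∷ʳ 0#) i ⟩
    (reversed p i + 0# * _) - reversed (Vec.map (a *_) p ∷ʳ 0#) i
      ≈⟨ +-cong (trans (+-congˡ (zeroˡ _)) (+-identityʳ _)) (-‿cong (trans
           (reversed-∷ʳ (Vec.map (a *_) p) 0# i) (trans (+-cong (scale i) (zeroˡ _)) (+-identityʳ _)))) ⟩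
    reversed p i - a * shift 1 (reversed p) i ∎
    where
    scale : ∀ i → shift 1 (reversed (Vec.map (a *_) p)) i ≈ a * shift 1 (reversed p) i
    scale zero    = sym (zeroʳ a)
    scale (suc i) = reversed-map a p i

  powerSum : ∀ {d} → (Fin d → Carrier) → ℕ → Carrier
  powerSum α n = sum (λ j → pow R (α j) n)

  -- Each root a multiplies the reversed polynomial by 1 - a x, whose negative logarithmic
  -- derivative is the geometric series ∑ aⁿ⁺¹ xⁿ.
  IsNewton-rootPoly : ∀ d α → IsNewton (reversed (rootPoly R d α)) (λ n → powerSum α (suc n))
  IsNewton-rootPoly zero    α =
    IsNewton-cong (λ i → sym (trans (+-identityˡ _) (*-identityˡ _))) (λ _ → refl) IsNewton-one
  IsNewton-rootPoly (suc d) α =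
    IsNewton-cong (λ i → sym (reversed-mulLinear (rootPoly R d (α ∘ Fin.suc)) a i)) (λ _ → +-comm _ _)
      (IsNewton-twist a 0 (λ n → pow R a (suc n)) geometric (IsNewton-rootPoly d (α ∘ Fin.suc)))
    where
    a = α Fin.zero
    geometric : ∀ n → pow R a (suc n) ≈ a * shift 1 (λ i → pow R a (suc i)) n + a * (fromℕ R 1 * one n)
    geometric zero    = sym (trans (+-cong (zeroʳ a) (*-congˡ (trans (*-congʳ fromℤ-1) (*-identityˡ _))))
                          (+-identityˡ _))
    geometric (suc n) = sym (trans (+-congˡ (trans (*-congˡ (zeroʳ _)) (zeroʳ a))) (+-identityʳ _))

-- Integer lifts of the power sums of the roots.

module IntegerPowerSums {c ℓ : Level} (R : CommutativeRing c ℓ) where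
  open CommutativeRing R hiding (zero)
  open NewtonIdentities R
  open IntegerImage R
  open Relation.Binary.Reasoning.Setoid setoid
  module Z = NewtonIdentities ℤₚ.+-*-commutativeRing

  fromℤ-conv : ∀ f g n → fromℤ R (Z.conv f g n) ≈ conv (fromℤ R ∘ f) (fromℤ R ∘ g) n
  fromℤ-conv f g zero    = fromℤ-* (f 0) (g 0)
  fromℤ-conv f g (suc n) = trans (fromℤ-+ (f (suc n) ℤ.* g 0) _)
    (+-cong (fromℤ-* (f (suc n)) (g 0)) (fromℤ-conv f (g ∘ suc) n))

  fromℤ-shift-one : ∀ k n → fromℤ R (Z.shift k Z.one n) ≈ shift k one n
  fromℤ-shift-one zero    zero    = fromℤ-1
  fromℤ-shift-one zero    (suc n) = refl
  fromℤ-shift-one (suc k) zero    = refl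
  fromℤ-shift-one (suc k) (suc n) = fromℤ-shift-one k n

  fromℤ-reversed : ∀ {n} (p : Vec ℤ n) i → fromℤ R (Z.reversed p i) ≈ reversed (Vec.map (fromℤ R) p) i
  fromℤ-reversed         []      i = refl
  fromℤ-reversed {suc n} (x ∷ p) i = trans (fromℤ-+ (Z.reversed p i) _)
    (+-cong (fromℤ-reversed p i) (trans (fromℤ-* x _) (*-congˡ (fromℤ-shift-one n i))))

  fromℤ-fromℕ : ∀ n → fromℤ R (fromℕ ℤₚ.+-*-commutativeRing n) ≈ fromℕ R n
  fromℤ-fromℕ zero    = refl
  fromℤ-fromℕ (suc n) = trans (fromℤ-+ (+ 1) (fromℕ ℤₚ.+-*-commutativeRing n)) (+-cong fromℤ-1 (fromℤ-fromℕ n))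

  fromℤ-IsNewton : ∀ f τ → Z.IsNewton f τ → IsNewton (fromℤ R ∘ f) (fromℤ R ∘ τ)
  fromℤ-IsNewton f τ newton n = begin
    conv (fromℤ R ∘ f) (fromℤ R ∘ τ) n    ≈⟨ fromℤ-conv f τ n ⟨
    fromℤ R (Z.conv f τ n)                ≡⟨ ≡.cong (fromℤ R) (newton n) ⟩
    fromℤ R (Z.-derivative f n)           ≈⟨ fromℤ-neg (fromℕ ℤₚ.+-*-commutativeRing (suc n) ℤ.* f (suc n)) ⟩
    - fromℤ R (fromℕ ℤₚ.+-*-commutativeRing (suc n) ℤ.* f (suc n))
      ≈⟨ -‿cong (trans (fromℤ-* (fromℕ ℤₚ.+-*-commutativeRing (suc n)) _) (*-congʳ (fromℤ-fromℕ (suc n)))) ⟩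
    -derivative (fromℤ R ∘ f) n ∎

  reversedMonic : ∀ {d} → Vec ℤ d → ℕ → ℤ
  reversedMonic a = Z.reversed (a ∷ʳ + 1)

  reversedMonic-0 : ∀ {d} (a : Vec ℤ d) → reversedMonic a 0 ≡.≡ + 1
  reversedMonic-0 a = Z.reversed-∷ʳ a (+ 1) 0

  -- The quotient -f′/f over ℤ; it stays integral because f has constant term 1. Index n belongs to
  -- the exponent n + 1.
  integerPowerSum : ∀ {d} → Vec ℤ d → ℕ → ℤ
  integerPowerSum a = Z.quot (reversedMonic a) (Z.-derivative (reversedMonic a))

  IsNewton-integerPowerSum : ∀ {d} (a : Vec ℤ d) → Z.IsNewton (reversedMonic a) (integerPowerSum a)
  IsNewton-integerPowerSum a = Z.conv-quot (reversedMonic a) _ (reversedMonic-0 a)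

  -- Splitting identifies the two reversed polynomials in `R`, and Newton's identities have only one
  -- solution there.
  powerSum≈fromℤ : ∀ {d} (a : Vec ℤ d) (α : Fin d → Carrier) → Splits R a α →
    ∀ n → powerSum α (suc n) ≈ fromℤ R (integerPowerSum a n)
  powerSum≈fromℤ {d} a α splits n = sym (conv-cancel n
    (trans (reflexive (≡.cong (fromℤ R) (reversedMonic-0 a))) fromℤ-1)
    (λ i _ → same i)
    (λ i _ → trans (fromℤ-IsNewton (reversedMonic a) (integerPowerSum a) (IsNewton-integerPowerSum a) i)
      (trans (-‿cong (*-congˡ (same (suc i)))) (sym (IsNewton-rootPoly d α i)))))
    where
    same : ∀ i → fromℤ R (reversedMonic a i) ≈ reversed (rootPoly R d α) i
    same i = trans (fromℤ-reversed (a ∷ʳ + 1) i) (sym (reversed-cong splits i))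

-- Integer combinations of the χᵢ.

module Dold where
  open ≡ using (_≡_; refl; sym; trans; cong; subst; module ≡-Reasoning)
  open import Data.Integer using (_+_; _*_; _-_; -_)
  open +-*-Solver using (solve; con; _:=_; _:+_; _:*_; _:-_; :-_)

  χ : ℕ → ℕ → ℤ
  χ i n with i ∣? n
  ... | yes _ = + i
  ... | no  _ = + 0

  χ-∣ : ∀ {i n} → i ∣ n → χ i n ≡ + i
  χ-∣ {i} {n} i∣n with i ∣? n
  ... | yes _  = refl
  ... | no i∤n = contradiction i∣n i∤n

  χ-∤ : ∀ {i n} → i ∤ n → χ i n ≡ + 0
  χ-∤ {i} {n} i∤n with i ∣? n
  ... | yes i∣n = contradiction i∣n i∤n
  ... | no _    = refl

  χ-* : ∀ i j n → χ i n * χ j n ≡ + gcd i j * χ (lcm i j) n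
  χ-* i j n with i ∣? n
  ... | no i∤n = sym (trans (cong (+ gcd i j *_) (χ-∤ (i∤n ∘ ∣-trans (m∣lcm[m,n] i j)))) (ℤₚ.*-zeroʳ (+ gcd i j)))
  ... | yes i∣n with j ∣? n
  ...   | no j∤n = trans (ℤₚ.*-zeroʳ (+ i))
            (sym (trans (cong (+ gcd i j *_) (χ-∤ (j∤n ∘ ∣-trans (n∣lcm[m,n] i j)))) (ℤₚ.*-zeroʳ (+ gcd i j))))
  ...   | yes j∣n = begin
    + i * + j                    ≡⟨ ℤₚ.pos-* i j ⟨
    + (i ℕ.* j)                  ≡⟨ cong +_ (gcd*lcm i j) ⟨
    + (gcd i j ℕ.* lcm i j)      ≡⟨ ℤₚ.pos-* (gcd i j) (lcm i j) ⟩
    + gcd i j * + lcm i j        ≡⟨ cong (+ gcd i j *_) (χ-∣ (lcm-least i∣n j∣n)) ⟨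
    + gcd i j * χ (lcm i j) n    ∎
    where open ≡-Reasoning

  -- With g = gcd i s, i divides n s exactly when i/g divides n: if i divides n s, it also divides n
  -- i, hence gcd(n i, n s) = n g.
  χ-dilate : ∀ i s .{{_ : ℕ.NonZero (gcd i s)}} n → χ i (n ℕ.* s) ≡ + gcd i s * χ (i / gcd i s) n
  χ-dilate i s n with i ∣? n ℕ.* s
  ... | yes i∣ns = begin
    + i                                ≡⟨ cong +_ (m*[n/m]≡n (gcd[m,n]∣m i s)) ⟨
    + (gcd i s ℕ.* (i / gcd i s))      ≡⟨ ℤₚ.pos-* (gcd i s) _ ⟩
    + gcd i s * + (i / gcd i s)        ≡⟨ cong (+ gcd i s *_) (χ-∣ i/g∣n) ⟨
    + gcd i s * χ (i / gcd i s) n      ∎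
    where
    open ≡-Reasoning
    i/g∣n : i / gcd i s ∣ n
    i/g∣n = m∣n*o⇒m/n∣o (gcd[m,n]∣m i s)
      (subst (i ∣_) (sym (c*gcd[m,n]≡gcd[cm,cn] n i s)) (gcd-greatest (n∣m*n n) i∣ns))
  ... | no i∤ns = sym (trans (cong (+ gcd i s *_) (χ-∤ {i / gcd i s} λ i/g∣n → i∤ns
    (∣-trans (m/n∣o⇒m∣o*n (gcd[m,n]∣m i s) i/g∣n) (*-monoʳ-∣ n (gcd[m,n]∣n i s))))) (ℤₚ.*-zeroʳ (+ gcd i s)))

  -- t agrees on 1, …, N with an integer combination of the χ i.
  data Dold (N : ℕ) : (ℕ → ℤ) → Set where
    nil  : ∀ {t} → (∀ n → n ℕ.< N → t (suc n) ≡ + 0) → Dold N t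
    cons : ∀ {t} i c → Dold N (λ n → t n - c * χ i n) → Dold N t

  Dold-resp : ∀ {N s t} → (∀ n → n ℕ.< N → s (suc n) ≡ t (suc n)) → Dold N s → Dold N t
  Dold-resp s≡t (nil z)      = nil (λ n n<N → trans (sym (s≡t n n<N)) (z n n<N))
  Dold-resp s≡t (cons i c d) = cons i c (Dold-resp (λ n n<N → cong (_- c * χ i (suc n)) (s≡t n n<N)) d)

  Dold-+ : ∀ {N s t} → Dold N s → Dold N t → Dold N (λ n → s n + t n)
  Dold-+ {t = t} (nil z) e =
    Dold-resp (λ n n<N → sym (trans (cong (_+ t (suc n)) (z n n<N)) (ℤₚ.+-identityˡ _))) e
  Dold-+ {s = s} {t} (cons i c d) e = cons i c (Dold-resp (λ n _ →
    solve 3 (λ s x t → (s :- x) :+ t := (s :+ t) :- x) refl (s (suc n)) (c * χ i (suc n)) (t (suc n))) (Dold-+ d e))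

  Dold-scale : ∀ {N t} a → Dold N t → Dold N (λ n → a * t n)
  Dold-scale a (nil z) = nil (λ n n<N → trans (cong (a *_) (z n n<N)) (ℤₚ.*-zeroʳ a))
  Dold-scale {t = t} a (cons i c d) = cons i (a * c) (Dold-resp (λ n _ →
    solve 4 (λ a t c x → a :* (t :- c :* x) := a :* t :- (a :* c) :* x) refl a (t (suc n)) c (χ i (suc n)))
    (Dold-scale a d))

  Dold-χ : ∀ {N} i → Dold N (χ i)
  Dold-χ i = cons i (+ 1) (nil (λ n _ →
    solve 1 (λ x → x :- con (+ 1) :* x := con (+ 0)) refl (χ i (suc n))))

  Dold-const : ∀ {N} a → Dold N (λ _ → a)
  Dold-const a = Dold-resp (λ n _ → trans (cong (a *_) (χ-∣ (1∣ suc n))) (ℤₚ.*-identityʳ a))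
    (Dold-scale a (Dold-χ 1))

  Dold-χ* : ∀ {N t} i → Dold N t → Dold N (λ n → χ i n * t n)
  Dold-χ* i (nil z) = nil (λ n n<N → trans (cong (χ i (suc n) *_) (z n n<N)) (ℤₚ.*-zeroʳ (χ i (suc n))))
  Dold-χ* {t = t} i (cons j c d) = Dold-resp (λ n _ → split (suc n))
    (Dold-+ (Dold-χ* i d) (Dold-scale (c * + gcd i j) (Dold-χ (lcm i j))))
    where
    open ≡-Reasoning
    split : ∀ n → χ i n * (t n - c * χ j n) + c * + gcd i j * χ (lcm i j) n ≡ χ i n * t n
    split n = begin
      χ i n * (t n - c * χ j n) + c * + gcd i j * χ (lcm i j) n
        ≡⟨ cong (λ u → χ i n * (t n - c * χ j n) + u)
             (trans (ℤₚ.*-assoc c (+ gcd i j) _) (cong (c *_) (sym (χ-* i j n)))) ⟩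
      χ i n * (t n - c * χ j n) + c * (χ i n * χ j n)
        ≡⟨ solve 4 (λ x t c y → x :* (t :- c :* y) :+ c :* (x :* y) := x :* t) refl (χ i n) (t n) c (χ j n) ⟩
      χ i n * t n ∎

  Dold-* : ∀ {N s t} → Dold N s → Dold N t → Dold N (λ n → s n * t n)
  Dold-* {t = t} (nil z) e = nil (λ n n<N → trans (cong (_* t (suc n)) (z n n<N)) (ℤₚ.*-zeroˡ (t (suc n))))
  Dold-* {s = s} {t} (cons i c d) e = Dold-resp (λ n _ →
      solve 4 (λ s c x t → (s :- c :* x) :* t :+ c :* (x :* t) := s :* t) refl (s (suc n)) c (χ i (suc n)) (t (suc n)))
    (Dold-+ (Dold-* d e) (Dold-scale c (Dold-χ* i e)))

  -- The dilated sequence up to N reads t up to N (s+1). The factor is a successor because `Dold`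
  -- says nothing about `t 0`.
  Dold-dilate : ∀ {N t} s → Dold (N ℕ.* suc s) t → Dold N (λ n → t (n ℕ.* suc s))
  Dold-dilate s (nil z) = nil (λ n n<N → z (s ℕ.+ n ℕ.* suc s) (ℕₚ.*-monoˡ-≤ (suc s) n<N))
  Dold-dilate {t = t} s (cons i c d) = Dold-resp (λ n _ → split (suc n))
    (Dold-+ (Dold-dilate s d) (Dold-scale (c * + g) (Dold-χ (i / g))))
    where
    open ≡-Reasoning
    g = gcd i (suc s)
    instance
      g≢0 : ℕ.NonZero g
      g≢0 = ℕ.≢-nonZero (gcd[m,n]≢0 i (suc s) (inj₂ λ ()))
    split : ∀ n → (t (n ℕ.* suc s) - c * χ i (n ℕ.* suc s)) + c * + g * χ (i / g) n ≡ t (n ℕ.* suc s)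
    split n = begin
      (t (n ℕ.* suc s) - c * χ i (n ℕ.* suc s)) + c * + g * χ (i / g) n
        ≡⟨ cong (λ u → t (n ℕ.* suc s) - c * χ i (n ℕ.* suc s) + u)
             (trans (ℤₚ.*-assoc c (+ g) _) (cong (c *_) (sym (χ-dilate i (suc s) n)))) ⟩
      (t (n ℕ.* suc s) - c * χ i (n ℕ.* suc s)) + c * χ i (n ℕ.* suc s)
        ≡⟨ solve 2 (λ t x → (t :- x) :+ x := t) refl (t (n ℕ.* suc s)) (c * χ i (n ℕ.* suc s)) ⟩
      t (n ℕ.* suc s) ∎

  -- Factoring integral series into powers of 1 - xⁱ.

  module Z = NewtonIdentities ℤₚ.+-*-commutativeRing

  shift-< : ∀ k f n → n ℕ.< k → Z.shift k f n ≡ + 0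
  shift-< (suc k) f zero    _         = refl
  shift-< (suc k) f (suc n) (s≤s n<k) = shift-< k f n n<k

  shift-≥ : ∀ k f n → Z.shift k f (k ℕ.+ n) ≡ f n
  shift-≥ zero    f n = refl
  shift-≥ (suc k) f n = shift-≥ k f n

  fromℕ-ℤ : ∀ n → fromℕ ℤₚ.+-*-commutativeRing n ≡ + n
  fromℕ-ℤ zero    = refl
  fromℕ-ℤ (suc n) = cong (ℤ._+_ (+ 1)) (fromℕ-ℤ n)

  -- The hypothesis of `IsNewton-twist` at a = 1: the series ∑ χ_(k+1)(n+1) xⁿ is (k+1) xᵏ / (1 -
  -- xᵏ⁺¹). Its coefficients vanish below k, equal k+1 at k, and then repeat with period k+1.
  χ-log-derivative : ∀ k n → χ (suc k) (suc n) ≡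
    + 1 * Z.shift (suc k) (χ (suc k) ∘ suc) n + + 1 * (fromℕ ℤₚ.+-*-commutativeRing (suc k) * Z.shift k Z.one n)
  χ-log-derivative k n = trans (cases (ℕₚ.<-cmp n k))
    (cong (λ K → + 1 * Z.shift (suc k) χ′ n + + 1 * (K * Z.shift k Z.one n)) (sym (fromℕ-ℤ (suc k))))
    where
    χ′ : ℕ → ℤ
    χ′ = χ (suc k) ∘ suc
    combine : ∀ {n x a b} → x ≡ + 1 * a + + 1 * (+ suc k * b) →
      Z.shift (suc k) χ′ n ≡ a → Z.shift k Z.one n ≡ b →
      x ≡ + 1 * Z.shift (suc k) χ′ n + + 1 * (+ suc k * Z.shift k Z.one n)
    combine eq refl refl = eq
    cases : ∀ {n} → Tri (n ℕ.< k) (n ≡ k) (k ℕ.< n) →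
      χ (suc k) (suc n) ≡ + 1 * Z.shift (suc k) χ′ n + + 1 * (+ suc k * Z.shift k Z.one n)
    cases {n} (tri< n<k _ _) = combine {n} {a = + 0} {b = + 0}
      (trans (χ-∤ {suc k} {suc n} (>⇒∤ (s≤s n<k))) (sym (cong (λ z → + 0 + + 1 * z) (ℤₚ.*-zeroʳ (+ suc k)))))
      (shift-< (suc k) χ′ n (ℕₚ.m<n⇒m<1+n n<k)) (shift-< k Z.one n n<k)
    cases (tri≈ _ refl _) = combine {k} {a = + 0} {b = + 1}
      (trans (χ-∣ {suc k} ∣-refl) (solve 1 (λ x → x := con (+ 0) :+ con (+ 1) :* (x :* con (+ 1))) refl (+ suc k)))
      (shift-< (suc k) χ′ k (ℕₚ.n<1+n k)) (trans (cong (Z.shift k Z.one) (sym (ℕₚ.+-identityʳ k))) (shift-≥ k Z.one 0))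
    cases {n} (tri> _ _ k<n) with ℕₚ.m≤n⇒∃[o]m+o≡n k<n
    ... | m , refl = combine {suc k ℕ.+ m} {a = χ′ m} {b = + 0}
      (trans periodic (solve 2 (λ x y → x := con (+ 1) :* x :+ con (+ 1) :* (y :* con (+ 0))) refl (χ′ m) (+ suc k)))
      (shift-≥ (suc k) χ′ m) (trans (cong (Z.shift k Z.one) (sym (ℕₚ.+-suc k m))) (shift-≥ k Z.one (suc m)))
      where
      periodic : χ (suc k) (suc (suc k ℕ.+ m)) ≡ χ (suc k) (suc m)
      periodic with suc k ∣? suc m
      ... | yes k∣m = χ-∣ (subst (suc k ∣_) (ℕₚ.+-suc (suc k) m) (∣m∣n⇒∣m+n ∣-refl k∣m))
      ... | no k∤m  = χ-∤ (λ k∣ → k∤m (∣m+n∣m⇒∣n (subst (suc k ∣_) (sym (ℕₚ.+-suc (suc k) m)) k∣) ∣-refl))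

  record NewtonPair : Set where
    field
      series      : ℕ → ℤ
      sequence    : ℕ → ℤ
      constant    : series 0 ≡ + 1
      isNewton    : Z.IsNewton series (sequence ∘ suc)
  open NewtonPair

  twisted : ℕ → NewtonPair → NewtonPair
  twisted k p = record
    { series   = Z.twist (+ 1) (suc k) (series p)
    ; sequence = λ n → sequence p n + χ (suc k) n
    ; constant = trans (ℤₚ.+-identityʳ _) (constant p)
    ; isNewton = Z.IsNewton-twist (+ 1) k (χ (suc k) ∘ suc) (χ-log-derivative k) (isNewton p)
    }

  twisted-series-< : ∀ k p i → i ℕ.< suc k → series (twisted k p) i ≡ series p i
  twisted-series-< k p i i≤k = trans (cong (λ z → series p i - + 1 * z) (shift-< (suc k) (series p) i i≤k)) (ℤₚ.+-identityʳ _)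

  -- The constant term 1 is moved onto xᵏ⁺¹, so each factor 1 - xᵏ⁺¹ lowers this coefficient by
  -- exactly one. A gap of e is closed by e factors.
  twisted-series-≡ : ∀ k p → series (twisted k p) (suc k) ≡ series p (suc k) - + 1
  twisted-series-≡ k p = cong (λ z → series p (suc k) - z)
    (trans (ℤₚ.*-identityˡ _) (trans (cong (Z.shift (suc k) (series p)) (sym (ℕₚ.+-identityʳ (suc k))))
      (trans (shift-≥ (suc k) (series p) 0) (constant p))))

  AgreeUpTo : ℕ → NewtonPair → NewtonPair → Set
  AgreeUpTo M p q = ∀ i → i ℕ.≤ M → series p i ≡ series q i

  difference : NewtonPair → NewtonPair → ℕ → ℤ
  difference p q n = sequence p n - sequence q n

  -- Both series are pushed together one coefficient at a time, by multiplying
  -- the one with the larger coefficient of xᵏ by a power of 1 - xᵏ.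
  agree⇒Dold : ∀ j M p q → AgreeUpTo M p q → Dold (j ℕ.+ M) (difference p q)
  reduce⇒Dold : ∀ j M e p q → AgreeUpTo M p q → series p (suc M) ≡ series q (suc M) + + e →
    Dold (j ℕ.+ suc M) (difference p q)

  -- Coefficient i of f′ uses f only at i+1, so agreement of the series up to degree M forces equal
  -- sequences on 1, ..., M.
  agree⇒Dold zero M p q p≡q = nil λ n n<M → ℤₚ.i≡j⇒i-j≡0
    (Z.conv-cancel n (constant p) (λ i i≤n → p≡q i (ℕₚ.≤-trans i≤n (ℕₚ.<⇒≤ n<M)))
      λ i i≤n → trans (isNewton p i) (trans
        (cong (λ z → - (fromℕ ℤₚ.+-*-commutativeRing (suc i) * z)) (p≡q (suc i) (ℕₚ.≤-trans (s≤s i≤n) n<M)))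
        (sym (isNewton q i))))
  agree⇒Dold (suc j) M p q p≡q = subst (λ N → Dold N (difference p q)) (ℕₚ.+-suc j M)
    (go (series p (suc M) - series q (suc M)) refl)
    where
    go : ∀ x → series p (suc M) - series q (suc M) ≡ x → Dold (j ℕ.+ suc M) (difference p q)
    go (+ e) eq = reduce⇒Dold j M e p q p≡q
      (trans (solve 2 (λ x y → x := y :+ (x :- y)) refl (series p (suc M)) (series q (suc M)))
        (cong (λ z → series q (suc M) + z) eq))
    -- A negative gap is treated by exchanging the two pairs and negating the result, so no factor 1
    -- - xᵏ is ever inverted.
    go -[1+ e ] eq = Dold-resp (λ n _ → solve 2 (λ x y → con -[1+ 0 ] :* (y :- x) := x :- y) refl
        (sequence p (suc n)) (sequence q (suc n)))
      (Dold-scale -[1+ 0 ] (reduce⇒Dold j M (suc e) q p (λ i i≤M → sym (p≡q i i≤M))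
        (trans (solve 2 (λ x y → y := x :+ :- (x :- y)) refl (series p (suc M)) (series q (suc M)))
          (cong (λ z → series p (suc M) - z) eq))))

  reduce⇒Dold j M zero p q p≡q eq = agree⇒Dold j (suc M) p q agree
    where
    agree : AgreeUpTo (suc M) p q
    agree i i≤1+M with ℕₚ.m≤n⇒m<n∨m≡n i≤1+M
    ... | inj₁ (s≤s i≤M) = p≡q i i≤M
    ... | inj₂ refl      = trans eq (ℤₚ.+-identityʳ _)
  -- Twisting p adds χ_(M+1) to its sequence whereas `cons` subtracts c χ_(M+1); hence c = -1.
  reduce⇒Dold j M (suc e) p q p≡q eq = cons (suc M) -[1+ 0 ]
    (Dold-resp (λ n _ → solve 3 (λ x c y → (x :+ c) :- y := (x :- y) :- con -[1+ 0 ] :* c) refl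
        (sequence p (suc n)) (χ (suc M) (suc n)) (sequence q (suc n)))
      (reduce⇒Dold j M e (twisted M p) q
        (λ i i≤M → trans (twisted-series-< M p i (s≤s i≤M)) (p≡q i i≤M))
        (trans (twisted-series-≡ M p) (trans (cong (_- + 1) eq)
          (solve 2 (λ y e → (y :+ (con (+ 1) :+ e)) :- con (+ 1) := y :+ e) refl (series q (suc M)) (+ e))))))

  trivial : NewtonPair
  trivial = record
    { series   = Z.one
    ; sequence = λ _ → + 0
    ; constant = refl
    ; isNewton = Z.IsNewton-one
    }

  -- The comparison with the empty product starts at degree 0, where both series have coefficient 1,
  -- and climbs N degrees.
  newton⇒Dold : ∀ p N → Dold N (sequence p)
  newton⇒Dold p N = subst (λ N → Dold N (sequence p)) (ℕₚ.+-identityʳ N)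
    (Dold-resp (λ n _ → ℤₚ.+-identityʳ _)
      (agree⇒Dold N 0 p trivial (λ { _ z≤n → constant p })))

-- From power sums to the discriminants Δ(P_n).

module DoldSequences {c ℓ : Level} (R : CommutativeRing c ℓ) where
  open CommutativeRing R hiding (zero)
  open Algebra.Properties.Semiring.Sum semiring
  open IntegerImage R
  open Solver using (solve; con; _:=_; _:+_; _:*_; _:-_; :-_)
  open Dold
  open NewtonIdentities R using (powerSum)

  -- The lift is carried as data, since it cannot be recovered from its image in `R`. One lift
  -- serves all N because dilation consumes a larger bound than it delivers.
  record IsDold (s : ℕ → Carrier) : Set ℓ where
    constructor isDold
    field
      lift    : ℕ → ℤ
      isLift  : ∀ n → s (suc n) ≈ fromℤ R (lift (suc n))
      dold    : ∀ N → Dold N lift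

  IsDold-cong : ∀ {s s′} → (∀ n → s n ≈ s′ n) → IsDold s → IsDold s′
  IsDold-cong s≈s′ (isDold t s≈t dold) = isDold t (λ n → trans (sym (s≈s′ (suc n))) (s≈t n)) dold

  IsDold-const : ∀ i → IsDold (λ _ → fromℤ R i)
  IsDold-const i = isDold (λ _ → i) (λ _ → refl) (λ _ → Dold-const i)

  IsDold-+ : ∀ {s s′} → IsDold s → IsDold s′ → IsDold (λ n → s n + s′ n)
  IsDold-+ (isDold t s≈t dold) (isDold t′ s′≈t′ dold′) = isDold
    (λ n → t n ℤ.+ t′ n)
    (λ n → trans (+-cong (s≈t n) (s′≈t′ n)) (sym (fromℤ-+ (t (suc n)) (t′ (suc n)))))
    (λ N → Dold-+ (dold N) (dold′ N))

  IsDold-* : ∀ {s s′} → IsDold s → IsDold s′ → IsDold (λ n → s n * s′ n)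
  IsDold-* (isDold t s≈t dold) (isDold t′ s′≈t′ dold′) = isDold
    (λ n → t n ℤ.* t′ n)
    (λ n → trans (*-cong (s≈t n) (s′≈t′ n)) (sym (fromℤ-* (t (suc n)) (t′ (suc n)))))
    (λ N → Dold-* (dold N) (dold′ N))

  IsDold-neg : ∀ {s} → IsDold s → IsDold (λ n → - s n)
  IsDold-neg {s} good = IsDold-cong (λ n → solve 1 (λ x → con -[1+ 0 ] :* x := :- x) refl (s n))
    (IsDold-* (IsDold-const -[1+ 0 ]) good)

  pow-+ : ∀ x m n → pow R x (m ℕ.+ n) ≈ pow R x m * pow R x n
  pow-+ x zero    n = sym (*-identityˡ _)
  pow-+ x (suc m) n = trans (*-congˡ (pow-+ x m n)) (sym (*-assoc _ _ _))

  pow-pow : ∀ x m n → pow R (pow R x m) n ≈ pow R x (m ℕ.* n)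
  pow-pow x m zero    = reflexive (≡.cong (pow R x) (≡.sym (ℕₚ.*-zeroʳ m)))
  pow-pow x m (suc n) = trans (*-congˡ (pow-pow x m n))
    (trans (sym (pow-+ x m (m ℕ.* n))) (reflexive (≡.cong (pow R x) (≡.sym (ℕₚ.*-suc m n)))))

  -- For e > 0 this is dilation by e. The exponent 0 is separate: it would read the lift at index 0,
  -- and the sum is the constant d.
  IsDold-powerSum : ∀ {d} (α : Fin d → Carrier) → IsDold (powerSum α) →
    ∀ e → IsDold (λ n → powerSum (λ j → pow R (α j) n) e)
  IsDold-powerSum {d} α good zero = IsDold-cong (λ _ → count d) (IsDold-const (+ d))
    where
    count : ∀ d → fromℕ R d ≈ sum {d} (λ _ → 1#)
    count zero    = refl
    count (suc d) = +-congˡ (count d)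
  IsDold-powerSum α (isDold t s≈t dold) (suc e) = isDold
    (λ n → t (n ℕ.* suc e))
    (λ n → trans (sum-cong-≋ (λ j → pow-pow (α j) (suc n) (suc e))) (s≈t (e ℕ.+ n ℕ.* suc e)))
    (λ N → Dold-dilate e (dold (N ℕ.* suc e)))

  module _ {d : ℕ} (α : Fin d → Carrier) (power-sums : IsDold (powerSum α)) where

    b : ℕ → Fin d → Carrier
    b n x = pow R (α x) n

    -- The head is summed innermost, so summing out the most recently chosen root is one unfolding
    -- of the definition.
    sumVec : ∀ m → (Vec (Fin d) m → Carrier) → Carrier
    sumVec zero    G = G []
    sumVec (suc m) G = sumVec m (λ xs → sum (λ x → G (x ∷ xs)))

    sumVec-cong : ∀ m {G H : Vec (Fin d) m → Carrier} → (∀ xs → G xs ≈ H xs) → sumVec m G ≈ sumVec m H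
    sumVec-cong zero    G≈H = G≈H []
    sumVec-cong (suc m) G≈H = sumVec-cong m (λ xs → sum-cong-≋ (λ x → G≈H (x ∷ xs)))

    sumVec-+ : ∀ m (G H : Vec (Fin d) m → Carrier) →
      sumVec m (λ xs → G xs + H xs) ≈ sumVec m G + sumVec m H
    sumVec-+ zero    G H = refl
    sumVec-+ (suc m) G H = trans (sumVec-cong m (λ xs → ∑-distrib-+ (λ x → G (x ∷ xs)) _)) (sumVec-+ m _ _)

    sumVec-*ˡ : ∀ m a (G : Vec (Fin d) m → Carrier) → sumVec m (λ xs → a * G xs) ≈ a * sumVec m G
    sumVec-*ˡ zero    a G = refl
    sumVec-*ˡ (suc m) a G =
      trans (sumVec-cong m (λ xs → sym (*-distribˡ-sum a (λ x → G (x ∷ xs))))) (sumVec-*ˡ m a _)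

    monomial : ∀ {m} → ℕ → Vec ℕ m → Vec (Fin d) m → Carrier
    monomial n []       []       = 1#
    monomial n (e ∷ es) (x ∷ xs) = pow R (b n x) e * monomial n es xs

    monomial-updateAt : ∀ {m} n (es : Vec ℕ m) xs i →
      monomial n (updateAt es i suc) xs ≈ b n (lookup xs i) * monomial n es xs
    monomial-updateAt n (e ∷ es) (x ∷ xs) Fin.zero    = *-assoc _ _ _
    monomial-updateAt n (e ∷ es) (x ∷ xs) (Fin.suc i) = trans (*-congˡ (monomial-updateAt n es xs i))
      (solve 3 (λ p y q → p :* (y :* q) := y :* (p :* q)) refl _ _ _)

    -- Monomials are included so that the class is closed under products with
    -- polynomials in the b n (lookup xs i).
    SumsToDold : ∀ {m} → (ℕ → Vec (Fin d) m → Carrier) → Set ℓ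
    SumsToDold {m} G = ∀ es → IsDold (λ n → sumVec m (λ xs → monomial n es xs * G n xs))

    SumsToDold-cong : ∀ {m} {G H : ℕ → Vec (Fin d) m → Carrier} →
      (∀ n xs → G n xs ≈ H n xs) → SumsToDold G → SumsToDold H
    SumsToDold-cong {m} G≈H good es =
      IsDold-cong (λ n → sumVec-cong m (λ xs → *-congˡ (G≈H n xs))) (good es)

    -- A sum of pure monomials over independent variables factors into one power sum per exponent.
    SumsToDold-one : ∀ m → SumsToDold {m} (λ _ _ → 1#)
    SumsToDold-one zero    []       =
      IsDold-cong (λ _ → trans fromℤ-1 (sym (*-identityˡ 1#))) (IsDold-const (+ 1))
    SumsToDold-one (suc m) (e ∷ es) =
      IsDold-cong factor (IsDold-* (IsDold-powerSum α power-sums e) (SumsToDold-one m es))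
      where
      factor : ∀ n → powerSum (b n) e * sumVec m (λ xs → monomial n es xs * 1#) ≈
        sumVec (suc m) (λ xs → monomial n (e ∷ es) xs * 1#)
      factor n = trans (sym (sumVec-*ˡ m (powerSum (b n) e) (λ xs → monomial n es xs * 1#))) (sumVec-cong m (λ xs →
        trans (*-distribʳ-sum (monomial n es xs * 1#) (λ x → pow R (b n x) e))
          (sum-cong-≋ (λ x → sym (*-assoc (pow R (b n x) e) _ _)))))

    SumsToDold-+ : ∀ {m} {G H : ℕ → Vec (Fin d) m → Carrier} →
      SumsToDold G → SumsToDold H → SumsToDold (λ n xs → G n xs + H n xs)
    SumsToDold-+ {m} G-good H-good es = IsDold-cong
      (λ n → trans (sym (sumVec-+ m _ _)) (sumVec-cong m (λ xs → sym (distribˡ _ _ _))))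
      (IsDold-+ (G-good es) (H-good es))

    SumsToDold-neg : ∀ {m} {G : ℕ → Vec (Fin d) m → Carrier} →
      SumsToDold G → SumsToDold (λ n xs → - G n xs)
    SumsToDold-neg {m} {G} good es = IsDold-cong
      (λ n → trans (solve 1 (λ x → :- x := con -[1+ 0 ] :* x) refl _)
        (trans (sym (sumVec-*ˡ m _ _)) (sumVec-cong m (λ xs →
          solve 2 (λ p x → con -[1+ 0 ] :* (p :* x) := p :* (:- x)) refl (monomial n es xs) (G n xs)))))
      (IsDold-neg (good es))

    SumsToDold-sum : ∀ {m} (G : ℕ → Vec (Fin d) (suc m) → Carrier) →
      SumsToDold G → SumsToDold (λ n xs → sum (λ x → G n (x ∷ xs)))
    SumsToDold-sum {m} G good es = IsDold-cong
      (λ n → sumVec-cong m (λ xs → trans (sum-cong-≋ {d} (λ x → *-congʳ {x = G n (x ∷ xs)} (*-identityˡ _)))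
        (sym (*-distribˡ-sum (monomial n es xs) (λ x → G n (x ∷ xs))))))
      -- The variable being summed out enters the monomial with exponent 0.
      (good (0 ∷ es))

    -- Formulated as preserving the class, so that a product of factors is a composition. Closure of
    -- `IsDold` under products would not suffice, as the product here stands inside the sum.
    Multiplier : ∀ {m} → (ℕ → Vec (Fin d) m → Carrier) → Set (c Level.⊔ ℓ)
    Multiplier {m} F = ∀ {G : ℕ → Vec (Fin d) m → Carrier} →
      SumsToDold G → SumsToDold (λ n xs → F n xs * G n xs)

    Multiplier-one : ∀ {m} → Multiplier {m} (λ _ _ → 1#)
    Multiplier-one = SumsToDold-cong (λ _ _ → sym (*-identityˡ _))

    Multiplier-* : ∀ {m} {F F′ : ℕ → Vec (Fin d) m → Carrier} →
      Multiplier F → Multiplier F′ → Multiplier (λ n xs → F n xs * F′ n xs)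
    Multiplier-* mF mF′ good = SumsToDold-cong (λ _ _ → sym (*-assoc _ _ _)) (mF (mF′ good))

    -- The factor is absorbed by raising one exponent of the monomial, which is why `SumsToDold`
    -- ranges over all exponents.
    Multiplier-lookup : ∀ {m} (i : Fin m) → Multiplier (λ n xs → b n (lookup xs i))
    Multiplier-lookup {m} i {G} good es = IsDold-cong
      (λ n → sumVec-cong m (λ xs → trans (*-congʳ (monomial-updateAt n es xs i))
        (solve 3 (λ y p g → (y :* p) :* g := p :* (y :* g)) refl (b n (lookup xs i)) (monomial n es xs) (G n xs))))
      (good (updateAt es i suc))

    Multiplier-difference : ∀ {m} (i j : Fin m) → Multiplier (λ n xs → b n (lookup xs i) - b n (lookup xs j))
    Multiplier-difference i j {G} good = SumsToDold-cong
      (λ n xs → solve 3 (λ x y g → x :* g :+ :- (y :* g) := (x :- y) :* g) refl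
        (b n (lookup xs i)) (b n (lookup xs j)) (G n xs))
      (SumsToDold-+ (Multiplier-lookup i good) (SumsToDold-neg (Multiplier-lookup j good)))

    Multiplier-pow : ∀ {m} (i : Fin m) k → Multiplier (λ n xs → pow R (b n (lookup xs i)) k)
    Multiplier-pow i zero    = Multiplier-one
    Multiplier-pow i (suc k) = Multiplier-* (Multiplier-lookup i) (Multiplier-pow i k)

    Multiplier-prodFin : ∀ {m} r {F : Fin r → ℕ → Vec (Fin d) m → Carrier} →
      (∀ l → Multiplier (F l)) → Multiplier (λ n xs → prodFin R r (λ l → F l n xs))
    Multiplier-prodFin zero    mF = Multiplier-one
    Multiplier-prodFin (suc r) mF = Multiplier-* (mF Fin.zero) (Multiplier-prodFin r (mF ∘ Fin.suc))

    open Discriminant R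

    -- Here j roots are already chosen and m remain; the weight collects the differences from the
    -- chosen ones. Choosing one more root turns the weight into the same product over j+1 roots by
    -- definition.
    SumsToDold-vandermondeSum : ∀ m k j → SumsToDold {j} (λ n xs →
      vandermondeSum (b n) m k (λ y → prodFin R j (λ l → b n y - b n (lookup xs l))))
    SumsToDold-vandermondeSum zero    k j = SumsToDold-one j
    SumsToDold-vandermondeSum (suc m) k j = SumsToDold-sum (λ n ys → (power n ys * differences n ys) * inner n ys)
      (Multiplier-* {F = power} {differences} (λ {G} → Multiplier-pow Fin.zero k {G})
        (λ {G} → Multiplier-prodFin j {δ} (λ l {G} → Multiplier-difference Fin.zero (Fin.suc l) {G}) {G}) {inner}
        (SumsToDold-vandermondeSum m (suc k) (suc j)))
      where
      δ : Fin j → ℕ → Vec (Fin d) (suc j) → Carrier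
      δ l n ys = b n (lookup ys Fin.zero) - b n (lookup ys (Fin.suc l))
      power differences inner : ℕ → Vec (Fin d) (suc j) → Carrier
      power n ys = pow R (b n (lookup ys Fin.zero)) k
      differences n ys = prodFin R j (λ l → δ l n ys)
      inner n ys = vandermondeSum (b n) m (suc k) (λ y → prodFin R (suc j) (λ l → b n y - b n (lookup ys l)))

    IsDold-ΔP : IsDold (ΔP R α)
    IsDold-ΔP = IsDold-cong
      (λ n → trans (*-identityˡ _) (trans (vandermondeSum≈discRoots d (b n) (λ _ → 1#))
        (trans (*-congʳ (prodFin-one d)) (*-identityˡ _))))
      (SumsToDold-vandermondeSum d 0 0 [])
      where
      prodFin-one : ∀ d → prodFin R d (λ _ → 1#) ≈ 1#
      prodFin-one zero    = refl
      prodFin-one (suc d) = trans (*-identityˡ _) (prodFin-one d)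

  IsDold-powerSum-Splits : ∀ {d} (a : Vec ℤ d) (α : Fin d → Carrier) → Splits R a α → IsDold (powerSum α)
  IsDold-powerSum-Splits a α splits =
    isDold (NewtonPair.sequence p) (powerSum≈fromℤ a α splits) (newton⇒Dold p)
    where
    open IntegerPowerSums R
    p : NewtonPair
    p = record
      { series   = reversedMonic a
      -- A default at 0; the true power sum of exponent 0 is d, supplied by `IsDold-powerSum`.
      ; sequence = λ { zero → + 0 ; (suc n) → integerPowerSum a n }
      ; constant = reversedMonic-0 a
      ; isNewton = IsNewton-integerPowerSum a
      }

-- Möbius sums and the congruence for integer sequences.

module MöbiusSums where
  open ≡ using (_≡_; refl; sym; trans; cong; cong₂; subst; setoid; module ≡-Reasoning)
  open import Data.Integer using (_+_; _*_; _-_; -_)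
  open +-*-Solver using (solve; con; _:=_; _:+_; _:*_; _:-_)
  open Data.List.Relation.Binary.Permutation.Setoid.Properties (setoid ℕ) using (Unique-resp-↭)
  open PrimeFactorisation using (isFactorisation; factorsPrime)
  open Dold

  -- Detaches μ from the list chosen by `factorise`: for p n one may then use p in front of the
  -- factors of n, a permutation of the chosen list by unique factorisation.
  listμ : List ℕ → ℤ
  listμ as with unique? as
  ... | yes _ = signPow (length as)
  ... | no  _ = + 0

  listμ-unique : ∀ as → Unique as → listμ as ≡ signPow (length as)
  listμ-unique as u with unique? as
  ... | yes _ = refl
  ... | no ¬u = contradiction u ¬u

  listμ-¬unique : ∀ as → ¬ Unique as → listμ as ≡ + 0
  listμ-¬unique as ¬u with unique? as
  ... | yes u = contradiction u ¬u
  ... | no _  = refl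

  listμ-↭ : ∀ {as bs} → as ↭ bs → listμ as ≡ listμ bs
  listμ-↭ {as} {bs} p with unique? as
  ... | yes u = sym (trans (listμ-unique bs (Unique-resp-↭ (↭⇒↭ₛ p) u)) (cong signPow (sym (↭-length p))))
  ... | no ¬u = sym (listμ-¬unique bs (¬u ∘ Unique-resp-↭ (↭⇒↭ₛ (↭-sym p))))

  listμ-∷-∉ : ∀ {p} as → p ∉ as → listμ (p ∷ as) ≡ - listμ as
  listμ-∷-∉ {p} as p∉as = cases (unique? as)
    where
    cases : Dec (Unique as) → listμ (p ∷ as) ≡ - listμ as
    cases (yes u) = trans (listμ-unique (p ∷ as) (¬Any⇒All¬ as p∉as ∷ u)) (cong -_ (sym (listμ-unique as u)))
    cases (no ¬u) = trans (listμ-¬unique (p ∷ as) (λ { (_ ∷ u) → ¬u u })) (cong -_ (sym (listμ-¬unique as ¬u)))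

  listμ-∷-∈ : ∀ {p} as → p ∈ as → listμ (p ∷ as) ≡ + 0
  listμ-∷-∈ {p} as p∈as = listμ-¬unique (p ∷ as) λ { (p∉as ∷ _) → All¬⇒¬Any p∉as p∈as }

  μ≡listμ : ∀ n .{{_ : NonZero n}} → μ n ≡ listμ (factors (factorise n))
  μ≡listμ (suc n) with unique? (factors (factorise (suc n)))
  ... | yes _ = refl
  ... | no _  = refl

  module _ {p} (p-prime : Prime p) (n : ℕ) .{{n≢0 : NonZero n}} where
    private
      instance
        p≢0 : NonZero p
        p≢0 = prime⇒nonZero p-prime
        pn≢0 : NonZero (p ℕ.* n)
        pn≢0 = ℕₚ.m*n≢0 p n

      ps : List ℕ
      ps = factors (factorise n)

      μ-prime* : μ (p ℕ.* n) ≡ listμ (p ∷ ps)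
      μ-prime* = trans (μ≡listμ (p ℕ.* n)) (listμ-↭ (factorisationUnique (factorise (p ℕ.* n)) record
        { factors         = p ∷ ps
        ; isFactorisation = cong (p ℕ.*_) (isFactorisation (factorise n))
        ; factorsPrime    = p-prime ∷ factorsPrime (factorise n)
        }))

    μ-prime*-∤ : p ∤ n → μ (p ℕ.* n) ≡ - μ n
    μ-prime*-∤ p∤n = trans μ-prime* (trans
      (listμ-∷-∉ ps (λ p∈ → p∤n (subst (p ∣_) (sym (isFactorisation (factorise n))) (∈⇒∣product {ns = ps} p∈))))
      (cong -_ (sym (μ≡listμ n))))

    μ-prime*-∣ : p ∣ n → μ (p ℕ.* n) ≡ + 0
    μ-prime*-∣ p∣n = trans μ-prime* (listμ-∷-∈ ps (factorisationHasAllPrimeFactors p-prime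
      (subst (p ∣_) (isFactorisation (factorise n)) p∣n) (factorsPrime (factorise n))))

  primeDivisor : ∀ n .{{_ : NonZero n}} → n ≡ 1 ⊎ ∃[ p ] Prime p × p ∣ n
  primeDivisor n with factorise n
  ... | record { factors = [] ; isFactorisation = n≡1 } = inj₁ n≡1
  ... | record { factors = p ∷ ps ; isFactorisation = n≡ ; factorsPrime = p-prime ∷ _ } =
    inj₂ (p , p-prime , subst (p ∣_) (sym n≡) (m∣m*n _))

  sum₁ : ℕ → (ℕ → ℤ) → ℤ
  sum₁ zero    f = + 0
  sum₁ (suc n) f = sum₁ n f + f (suc n)

  sum₁-cong : ∀ n {f g : ℕ → ℤ} → (∀ i → i ℕ.< n → f (suc i) ≡ g (suc i)) → sum₁ n f ≡ sum₁ n g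
  sum₁-cong zero    f≡g = refl
  sum₁-cong (suc n) f≡g =
    cong₂ _+_ (sum₁-cong n (λ i i<n → f≡g i (ℕₚ.m<n⇒m<1+n i<n))) (f≡g n (ℕₚ.n<1+n n))

  sum₁-zero : ∀ n {f : ℕ → ℤ} → (∀ i → i ℕ.< n → f (suc i) ≡ + 0) → sum₁ n f ≡ + 0
  sum₁-zero zero    f≡0 = refl
  sum₁-zero (suc n) f≡0 =
    cong₂ _+_ (sum₁-zero n (λ i i<n → f≡0 i (ℕₚ.m<n⇒m<1+n i<n))) (f≡0 n (ℕₚ.n<1+n n))

  sum₁-+ : ∀ n (f g : ℕ → ℤ) → sum₁ n (λ i → f i + g i) ≡ sum₁ n f + sum₁ n g
  sum₁-+ zero    f g = refl
  sum₁-+ (suc n) f g = trans (cong (_+ (f (suc n) + g (suc n))) (sum₁-+ n f g))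
    (solve 4 (λ a b c d → (a :+ b) :+ (c :+ d) := (a :+ c) :+ (b :+ d)) refl (sum₁ n f) (sum₁ n g) (f (suc n)) (g (suc n)))

  sum₁-*ʳ : ∀ n c (f : ℕ → ℤ) → sum₁ n (λ i → f i * c) ≡ sum₁ n f * c
  sum₁-*ʳ zero    c f = sym (ℤₚ.*-zeroˡ c)
  sum₁-*ʳ (suc n) c f = trans (cong (_+ f (suc n) * c) (sum₁-*ʳ n c f))
    (sym (ℤₚ.*-distribʳ-+ c (sum₁ n f) (f (suc n))))

  sum₁-split : ∀ m n (f : ℕ → ℤ) → sum₁ (m ℕ.+ n) f ≡ sum₁ m f + sum₁ n (λ i → f (m ℕ.+ i))
  sum₁-split m zero    f = trans (cong (λ k → sum₁ k f) (ℕₚ.+-identityʳ m)) (sym (ℤₚ.+-identityʳ _))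
  sum₁-split m (suc n) f = begin
    sum₁ (m ℕ.+ suc n) f
      ≡⟨ cong (λ k → sum₁ k f) (ℕₚ.+-suc m n) ⟩
    sum₁ (m ℕ.+ n) f + f (suc (m ℕ.+ n))
      ≡⟨ cong₂ _+_ (sum₁-split m n f) (cong f (sym (ℕₚ.+-suc m n))) ⟩
    (sum₁ m f + sum₁ n (λ i → f (m ℕ.+ i))) + f (m ℕ.+ suc n)
      ≡⟨ ℤₚ.+-assoc (sum₁ m f) _ _ ⟩
    sum₁ m f + (sum₁ n (λ i → f (m ℕ.+ i)) + f (m ℕ.+ suc n)) ∎
    where open ≡-Reasoning

  -- In each block of i consecutive indices only the last is a multiple of i.
  sum₁-multiples : ∀ k i .{{_ : NonZero i}} (f : ℕ → ℤ) → (∀ m → i ∤ m → f m ≡ + 0) →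
    sum₁ (k ℕ.* i) f ≡ sum₁ k (λ e → f (e ℕ.* i))
  sum₁-multiples zero    i         f f≡0 = refl
  sum₁-multiples (suc k) i@(suc j) f f≡0 = begin
    sum₁ (i ℕ.+ k ℕ.* i) f
      ≡⟨ cong (λ n → sum₁ n f) (ℕₚ.+-comm i (k ℕ.* i)) ⟩
    sum₁ (k ℕ.* i ℕ.+ i) f
      ≡⟨ sum₁-split (k ℕ.* i) i f ⟩
    sum₁ (k ℕ.* i) f + (sum₁ j (λ l → f (k ℕ.* i ℕ.+ l)) + f (k ℕ.* i ℕ.+ i))
      ≡⟨ cong₂ _+_ (sum₁-multiples k i f f≡0) (cong₂ _+_ (sum₁-zero j within)
           (cong f (ℕₚ.+-comm (k ℕ.* i) i))) ⟩
    sum₁ k (λ e → f (e ℕ.* i)) + (+ 0 + f (suc k ℕ.* i))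
      ≡⟨ cong (λ z → sum₁ k (λ e → f (e ℕ.* i)) + z) (ℤₚ.+-identityˡ _) ⟩
    sum₁ k (λ e → f (e ℕ.* i)) + f (suc k ℕ.* i) ∎
    where
    open ≡-Reasoning
    within : ∀ l → l ℕ.< j → f (k ℕ.* i ℕ.+ suc l) ≡ + 0
    within l l<j = f≡0 _ (λ i∣ → >⇒∤ (s≤s l<j) (∣m+n∣m⇒∣n i∣ (n∣m*n k)))

  quotientμ : ℕ → ℕ → ℤ
  quotientμ n m with m ∣? n
  ... | yes (divides d _) = μ d
  ... | no  _             = + 0

  quotientμ-∣ : ∀ {n} m d .{{_ : NonZero m}} → n ≡ d ℕ.* m → quotientμ n m ≡ μ d
  quotientμ-∣ {n} m d n≡dm with m ∣? n
  ... | yes (divides d′ n≡d′m) = cong μ (ℕₚ.*-cancelʳ-≡ d′ d m (trans (sym n≡d′m) n≡dm))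
  ... | no m∤n                 = contradiction (divides d n≡dm) m∤n

  quotientμ-∤ : ∀ {n m} → m ∤ n → quotientμ n m ≡ + 0
  quotientμ-∤ {n} {m} m∤n with m ∣? n
  ... | yes m∣n = contradiction m∣n m∤n
  ... | no _    = refl

  quotientμ-cancel : ∀ n m i .{{_ : NonZero m}} .{{_ : NonZero i}} →
    quotientμ (n ℕ.* i) (m ℕ.* i) ≡ quotientμ n m
  quotientμ-cancel n m i with m ∣? n
  ... | yes (divides d refl) = quotientμ-∣ (m ℕ.* i) d {{ℕₚ.m*n≢0 m i}} (ℕₚ.*-assoc d m i)
  ... | no m∤n = quotientμ-∤ (m∤n ∘ *-cancelʳ-∣ i)

  -- The divisors of q p are matched as e ↔ e p.  In the sum of μ (q p / e) the
  -- quotients divisible by p contribute - coprimePart e, the others coprimePart (e / p).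
  module _ {p : ℕ} (p-prime : Prime p) (q : ℕ) .{{q≢0 : NonZero q}} where
    private
      instance
        p≢0 : NonZero p
        p≢0 = prime⇒nonZero p-prime

    coprimePart : ℕ → ℤ
    coprimePart e with e ∣? q
    ... | no _ = + 0
    ... | yes (divides d _) with p ∣? d
    ...   | yes _ = + 0
    ...   | no _  = μ d

    coprimePart-∣ : ∀ e d .{{_ : NonZero e}} → q ≡ d ℕ.* e → p ∣ d → coprimePart e ≡ + 0
    coprimePart-∣ e d q≡de p∣d with e ∣? q
    ... | no _ = refl
    ... | yes (divides d′ q≡d′e) with p ∣? d′
    ...   | yes _   = refl
    ...   | no p∤d′ = contradiction (subst (p ∣_) (ℕₚ.*-cancelʳ-≡ d d′ e (trans (sym q≡de) q≡d′e)) p∣d) p∤d′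

    coprimePart-∤ : ∀ e d .{{_ : NonZero e}} → q ≡ d ℕ.* e → p ∤ d → coprimePart e ≡ μ d
    coprimePart-∤ e d q≡de p∤d with e ∣? q
    ... | no e∤q = contradiction (divides d q≡de) e∤q
    ... | yes (divides d′ q≡d′e) with ℕₚ.*-cancelʳ-≡ d d′ e (trans (sym q≡de) q≡d′e)
    ...   | refl with p ∣? d
    ...     | yes p∣d = contradiction p∣d p∤d
    ...     | no _    = refl

    coprimePart-nondivisor : ∀ e → e ∤ q → coprimePart e ≡ + 0
    coprimePart-nondivisor e e∤q with e ∣? q
    ... | yes e∣q = contradiction e∣q e∤q
    ... | no _    = refl

    shiftedPart : ℕ → ℤ
    shiftedPart e with p ∣? e
    ... | yes (divides e′ _) = coprimePart e′
    ... | no _               = + 0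

    shiftedPart-∣ : ∀ e′ → shiftedPart (e′ ℕ.* p) ≡ coprimePart e′
    shiftedPart-∣ e′ with p ∣? e′ ℕ.* p
    ... | yes (divides e″ e′p≡e″p) = cong coprimePart (ℕₚ.*-cancelʳ-≡ e″ e′ p (sym e′p≡e″p))
    ... | no p∤e′p                 = contradiction (n∣m*n e′) p∤e′p

    shiftedPart-∤ : ∀ e → p ∤ e → shiftedPart e ≡ + 0
    shiftedPart-∤ e p∤e with p ∣? e
    ... | yes p∣e = contradiction p∣e p∤e
    ... | no _    = refl

    shiftedPart-zero : ∀ e → (∀ e′ → e ≡ e′ ℕ.* p → coprimePart e′ ≡ + 0) → shiftedPart e ≡ + 0
    shiftedPart-zero e h with p ∣? e
    ... | yes (divides e′ e≡e′p) = h e′ e≡e′p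
    ... | no _                   = refl

    private
      regroup : ∀ d e′ → d ℕ.* (e′ ℕ.* p) ≡ (d ℕ.* p) ℕ.* e′
      regroup d e′ = trans (cong (d ℕ.*_) (ℕₚ.*-comm e′ p)) (sym (ℕₚ.*-assoc d p e′))

      factor≢0 : ∀ {e} e′ → .{{_ : NonZero e}} → e ≡ e′ ℕ.* p → NonZero e′
      factor≢0 e′ refl = ℕₚ.m*n≢0⇒m≢0 e′

    quotientμ-telescopes-∣ : ∀ e d .{{_ : NonZero e}} → q ≡ d ℕ.* e →
      quotientμ (q ℕ.* p) e ≡ shiftedPart e - coprimePart e
    quotientμ-telescopes-∣ e d q≡de = trans (quotientμ-∣ e (p ℕ.* d) qp≡) (trans (value (p ∣? d))
      (sym (trans (cong (_- coprimePart e) shifted≡0) (ℤₚ.+-identityˡ _))))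
      where
      qp≡ : q ℕ.* p ≡ p ℕ.* d ℕ.* e
      qp≡ = trans (ℕₚ.*-comm q p) (trans (cong (p ℕ.*_) q≡de) (sym (ℕₚ.*-assoc p d e)))
      instance
        d≢0 : NonZero d
        d≢0 = ℕₚ.m*n≢0⇒m≢0 d {{subst NonZero q≡de q≢0}}
      value : Dec (p ∣ d) → μ (p ℕ.* d) ≡ - coprimePart e
      value (yes p∣d) = trans (μ-prime*-∣ p-prime d p∣d) (cong -_ (sym (coprimePart-∣ e d q≡de p∣d)))
      value (no p∤d)  = trans (μ-prime*-∤ p-prime d p∤d) (cong -_ (sym (coprimePart-∤ e d q≡de p∤d)))
      -- If e = e′ p divides q, then q / e′ = d p is divisible by p, so `coprimePart e′` vanishes.
      shifted≡0 : shiftedPart e ≡ + 0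
      shifted≡0 = shiftedPart-zero e λ e′ e≡e′p → coprimePart-∣ e′ (d ℕ.* p) {{factor≢0 e′ e≡e′p}}
        (trans q≡de (trans (cong (d ℕ.*_) e≡e′p) (regroup d e′))) (n∣m*n d)

    -- If e divides q p but not q, Euclid's lemma gives e = e′ p, and the quotient is prime to p, as
    -- otherwise e would divide q.
    quotientμ-telescopes-∤ : ∀ e .{{_ : NonZero e}} → e ∤ q →
      quotientμ (q ℕ.* p) e ≡ shiftedPart e - coprimePart e
    quotientμ-telescopes-∤ e e∤q = trans (cases (e ∣? q ℕ.* p))
      (sym (trans (cong (λ z → shiftedPart e - z) (coprimePart-nondivisor e e∤q)) (ℤₚ.+-identityʳ _)))
      where
      cases : Dec (e ∣ q ℕ.* p) → quotientμ (q ℕ.* p) e ≡ shiftedPart e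
      cases (no e∤qp) = trans (quotientμ-∤ e∤qp) (sym (shiftedPart-zero e λ e′ e≡e′p →
        coprimePart-nondivisor e′ λ e′∣q → e∤qp (subst (_∣ q ℕ.* p) (sym e≡e′p) (*-monoˡ-∣ p e′∣q))))
      cases (yes (divides d qp≡de)) with euclidsLemma d e p-prime (subst (p ∣_) qp≡de (n∣m*n q))
      ... | inj₁ (divides d′ refl) = contradiction (divides d′ (ℕₚ.*-cancelʳ-≡ q (d′ ℕ.* e) p
              (trans qp≡de (trans (ℕₚ.*-assoc d′ p e) (trans (cong (d′ ℕ.*_) (ℕₚ.*-comm p e))
                (sym (ℕₚ.*-assoc d′ e p))))))) e∤q
      ... | inj₂ (divides e′ refl) = trans (quotientμ-∣ (e′ ℕ.* p) d qp≡de) (sym (trans (shiftedPart-∣ e′)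
              (coprimePart-∤ e′ d {{ℕₚ.m*n≢0⇒m≢0 e′}} q≡de′ p∤d)))
        where
        q≡de′ : q ≡ d ℕ.* e′
        q≡de′ = ℕₚ.*-cancelʳ-≡ q (d ℕ.* e′) p (trans qp≡de (sym (ℕₚ.*-assoc d e′ p)))
        p∤d : p ∤ d
        p∤d (divides d′ refl) = e∤q (divides d′ (trans q≡de′ (trans (ℕₚ.*-assoc d′ p e′)
          (cong (d′ ℕ.*_) (ℕₚ.*-comm p e′)))))

    quotientμ-telescopes : ∀ e .{{_ : NonZero e}} →
      quotientμ (q ℕ.* p) e ≡ shiftedPart e - coprimePart e
    quotientμ-telescopes e = cases (e ∣? q)
      where
      cases : Dec (e ∣ q) → quotientμ (q ℕ.* p) e ≡ shiftedPart e - coprimePart e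
      cases (yes (divides d q≡de)) = quotientμ-telescopes-∣ e d q≡de
      cases (no e∤q)               = quotientμ-telescopes-∤ e e∤q

    -- Substituting e = e′ p turns the shifted sum into that of `coprimePart` up to q; the unshifted
    -- one has no terms beyond q. The two cancel.
    sum-quotientμ-prime* : sum₁ (q ℕ.* p) (quotientμ (q ℕ.* p)) ≡ + 0
    sum-quotientμ-prime* = begin
      sum₁ (q ℕ.* p) (quotientμ (q ℕ.* p))
        ≡⟨ sum₁-cong (q ℕ.* p) (λ e _ → trans (quotientμ-telescopes (suc e))
             (cong (λ z → shiftedPart (suc e) + z) (trans (sym (ℤₚ.-1*i≡-i (coprimePart (suc e))))
               (ℤₚ.*-comm -[1+ 0 ] (coprimePart (suc e)))))) ⟩
      sum₁ (q ℕ.* p) (λ e → shiftedPart e + coprimePart e * -[1+ 0 ])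
        ≡⟨ trans (sum₁-+ (q ℕ.* p) shiftedPart _) (cong (λ z → sum₁ (q ℕ.* p) shiftedPart + z) (sum₁-*ʳ (q ℕ.* p) -[1+ 0 ] coprimePart)) ⟩
      sum₁ (q ℕ.* p) shiftedPart + sum₁ (q ℕ.* p) coprimePart * -[1+ 0 ]
        ≡⟨ cong₂ (λ x y → x + y * -[1+ 0 ]) shifted unshifted ⟩
      sum₁ q coprimePart + sum₁ q coprimePart * -[1+ 0 ]
        ≡⟨ solve 1 (λ x → x :+ x :* con -[1+ 0 ] := con (+ 0)) refl (sum₁ q coprimePart) ⟩
      + 0 ∎
      where
      open ≡-Reasoning
      shifted : sum₁ (q ℕ.* p) shiftedPart ≡ sum₁ q coprimePart
      shifted = trans (sum₁-multiples q p shiftedPart shiftedPart-∤) (sum₁-cong q (λ e _ → shiftedPart-∣ (suc e)))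
      unshifted : sum₁ (q ℕ.* p) coprimePart ≡ sum₁ q coprimePart
      unshifted with ℕₚ.m≤n⇒∃[o]m+o≡n (ℕₚ.m≤m*n q p)
      ... | r , q+r≡qp = begin
        sum₁ (q ℕ.* p) coprimePart
          ≡⟨ cong (λ n → sum₁ n coprimePart) q+r≡qp ⟨
        sum₁ (q ℕ.+ r) coprimePart
          ≡⟨ sum₁-split q r coprimePart ⟩
        sum₁ q coprimePart + sum₁ r (λ e → coprimePart (q ℕ.+ e))
          ≡⟨ cong (λ z → sum₁ q coprimePart + z) (sum₁-zero r (λ e _ → coprimePart-nondivisor (q ℕ.+ suc e)
               (>⇒∤ (ℕₚ.m<m+n q (s≤s z≤n))))) ⟩
        sum₁ q coprimePart + + 0
          ≡⟨ ℤₚ.+-identityʳ _ ⟩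
        sum₁ q coprimePart ∎

  möbiusSum : (ℕ → ℤ) → ℕ → ℤ
  möbiusSum t n = sum₁ n (λ m → quotientμ n m * t m)

  -- Only divisibility by k is wanted: at k = 1 it is automatic, and otherwise a prime divisor of k
  -- makes the sum zero.
  sum-quotientμ : ∀ k .{{_ : NonZero k}} → ∃[ x ] sum₁ k (quotientμ k) ≡ + k * x
  sum-quotientμ k with primeDivisor k
  ... | inj₁ refl = sum₁ 1 (quotientμ 1) , sym (ℤₚ.*-identityˡ _)
  ... | inj₂ (p , p-prime , divides q refl) =
    + 0 , trans (sum-quotientμ-prime* p-prime q {{ℕₚ.m*n≢0⇒m≢0 q}}) (sym (ℤₚ.*-zeroʳ (+ (q ℕ.* p))))

  -- For n = k i the surviving terms sit at m = e i and each carries the factor i; what remains is a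
  -- multiple of k, and k i = n.
  möbiusSum-χ : ∀ i n .{{_ : NonZero n}} → ∃[ x ] möbiusSum (χ i) n ≡ + n * x
  möbiusSum-χ i n with i ∣? n
  ... | no i∤n = + 0 , trans (sum₁-zero n vanish) (sym (ℤₚ.*-zeroʳ (+ n)))
    where
    vanish : ∀ m → m ℕ.< n → quotientμ n (suc m) * χ i (suc m) ≡ + 0
    vanish m _ with i ∣? suc m
    ... | no _    = ℤₚ.*-zeroʳ (quotientμ n (suc m))
    ... | yes i∣m = cong (_* + i) (quotientμ-∤ {n} (i∤n ∘ ∣-trans i∣m))
  ... | yes (divides k refl) with sum-quotientμ k {{ℕₚ.m*n≢0⇒m≢0 k}}
  ...   | x , sum≡kx = x , (begin
      möbiusSum (χ i) (k ℕ.* i)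
        ≡⟨ sum₁-multiples k i {{i≢0}} _ (λ m i∤m → trans (cong (quotientμ (k ℕ.* i) m *_) (χ-∤ i∤m))
             (ℤₚ.*-zeroʳ (quotientμ (k ℕ.* i) m))) ⟩
      sum₁ k (λ e → quotientμ (k ℕ.* i) (e ℕ.* i) * χ i (e ℕ.* i))
        ≡⟨ sum₁-cong k (λ e _ → cong₂ _*_ (quotientμ-cancel k (suc e) i {{_}} {{i≢0}}) (χ-∣ (n∣m*n (suc e)))) ⟩
      sum₁ k (λ e → quotientμ k e * + i)
        ≡⟨ trans (sum₁-*ʳ k (+ i) (quotientμ k)) (cong (_* + i) sum≡kx) ⟩
      + k * x * + i
        ≡⟨ solve 3 (λ k x i → k :* x :* i := k :* i :* x) refl (+ k) x (+ i) ⟩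
      + k * + i * x
        ≡⟨ cong (_* x) (ℤₚ.pos-* k i) ⟨
      + (k ℕ.* i) * x ∎)
    where
    open ≡-Reasoning
    i≢0 : NonZero i
    i≢0 = ℕₚ.m*n≢0⇒n≢0 k

  möbiusSum-Dold : ∀ {N t} → Dold N t → ∀ n .{{_ : NonZero n}} → n ℕ.≤ N → ∃[ x ] möbiusSum t n ≡ + n * x
  möbiusSum-Dold (nil z) n n≤N = + 0 , trans
    (sum₁-zero n (λ m m<n → trans (cong (quotientμ n (suc m) *_) (z m (ℕₚ.<-≤-trans m<n n≤N)))
      (ℤₚ.*-zeroʳ (quotientμ n (suc m)))))
    (sym (ℤₚ.*-zeroʳ (+ n)))
  möbiusSum-Dold {t = t} (cons i c d) n n≤N with möbiusSum-Dold d n n≤N | möbiusSum-χ i n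
  ... | x , sum≡nx | y , χ-sum≡ny = x + y * c , (begin
    möbiusSum t n
      ≡⟨ sum₁-cong n (λ m _ → solve 4 (λ q t c x → q :* t := q :* (t :- c :* x) :+ (q :* x) :* c) refl
           (quotientμ n (suc m)) (t (suc m)) c (χ i (suc m))) ⟩
    sum₁ n (λ m → quotientμ n m * (t m - c * χ i m) + (quotientμ n m * χ i m) * c)
      ≡⟨ trans (sum₁-+ n _ _) (cong₂ _+_ sum≡nx (trans (sum₁-*ʳ n c _) (cong (_* c) χ-sum≡ny))) ⟩
    + n * x + + n * y * c
      ≡⟨ solve 4 (λ n x y c → n :* x :+ n :* y :* c := n :* (x :+ y :* c)) refl (+ n) x y c ⟩
    + n * (x + y * c) ∎)
    where open ≡-Reasoning

-- The Möbius sum in `R` as the image of an integer sum.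

module _ {c ℓ : Level} (R : CommutativeRing c ℓ) where
  open CommutativeRing R hiding (zero)
  open IntegerImage R
  open DoldSequences R
  open Dold
  open MöbiusSums

  -- The indexing h is general because the tail of `applyUpTo h` uses `h ∘ suc`. The list grows at
  -- the front and `sum₁` at the end; `sum₁-split` reconciles them.
  sumList-upTo : ∀ n (g : ℕ → Carrier) (h : ℕ → ℕ) (f : ℕ → ℤ) →
    (∀ i → g (h i) ≈ fromℤ R (f (suc i))) → sumList R (List.map g (applyUpTo h n)) ≈ fromℤ R (sum₁ n f)
  sumList-upTo zero    g h f g≈f = refl
  sumList-upTo (suc n) g h f g≈f = trans
    (+-cong (g≈f 0) (sumList-upTo n g (h ∘ suc) (f ∘ suc) (g≈f ∘ suc)))
    (trans (sym (fromℤ-+ (f 1) _)) (reflexive (≡.cong (fromℤ R)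
      (≡.trans (≡.cong (ℤ._+ sum₁ n (f ∘ suc)) (≡.sym (ℤₚ.+-identityˡ (f 1)))) (≡.sym (sum₁-split 1 n f))))))

  möbiusDiscSum≈ : ∀ {d} (α : Fin d → Carrier) (t : ℕ → ℤ) → (∀ n → ΔP R α (suc n) ≈ fromℤ R (t (suc n))) →
    ∀ n → möbiusDiscSum R α n ≈ fromℤ R (möbiusSum t n)
  möbiusDiscSum≈ α t Δ≈t n = sumList-upTo n (proj₁ summand) id (λ m → quotientμ n m ℤ.* t m) summand≈
    where
    -- Gives access to the local function in the definition of möbiusDiscSum.
    summand : ∃[ g ] möbiusDiscSum R α n ≡.≡ sumList R (List.map g (upTo n))
    summand = _ , ≡.refl
    summand≈ : ∀ i → proj₁ summand i ≈ fromℤ R (quotientμ n (suc i) ℤ.* t (suc i))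
    summand≈ i with suc i ∣? n
    ... | no _              = refl
    ... | yes i∣n@(divides d _) = trans
      (*-cong (reflexive (≡.cong (fromℤ R ∘ μ) (n/m≡quotient i∣n))) (Δ≈t i))
      (sym (fromℤ-* (μ d) (t (suc i))))

theorem5p1 : ∀ {c ℓ : Level} (R : CommutativeRing c ℓ) (d : ℕ) (a : Vec ℤ d)
    (α : Fin d → CommutativeRing.Carrier R) → Splits R a α →
    (n : ℕ) → 1 ≤ n →
    ∃[ k ] CommutativeRing._≈_ R (möbiusDiscSum R α n) (fromℤ R ((+ n) ℤ.* k))
theorem5p1 R d a α splits n@(suc _) 1≤n = proj₁ divisible , trans
    (möbiusDiscSum≈ R α lift isLift n)
    (reflexive (≡.cong (fromℤ R) (proj₂ divisible)))
  where
  open CommutativeRing R using (trans; reflexive)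
  open DoldSequences R
  open IsDold (IsDold-ΔP α (IsDold-powerSum-Splits a α splits))
  divisible : ∃[ k ] MöbiusSums.möbiusSum lift n ≡.≡ (+ n) ℤ.* k
  divisible = MöbiusSums.möbiusSum-Dold (dold n) n ℕₚ.≤-refl
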